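{- Let $k\ge3$ and $j\in\mathbb{N}$. The Fourier coefficients (in $q$) of $f_{k,j}(\tau)+\frac{B_j}{2j}$ are integers.
   Context: $\tau\in\mathbb{H}$, $q=e^{2\pi i\tau}$, $\zeta=e^{2\pi iz}$, $(a)_n=\prod_{m=0}^{n-1}(1-aq^m)$, $B_j$ Bernoulli numbers. For $k\ge3$, $FG_k(\zeta,q)=\sum_{n_{k-1}\geq\dots\geq n_1\geq 1}\frac{q^{n_1^2+\dots+n_{k-1}^2}}{(q)_{n_{k-1}-n_{k-2}}\cdots(q)_{n_2-n_1}(\zeta q)_{n_1}(\zeta^{ -1}q)_{n_1}}$, $\theta_{a,b}(\tau)=\sum_{n\in\mathbb{Z}}(-1)^nq^{(bn^2+an)/2}$, and $f_{k,j}$ ($j\in\mathbb{N}$) are defined by $$FG_k(\zeta,q)+\frac{\theta_{1,2k-1}(\tau)}{(q)_\infty}=\frac{\sin(\pi z)}{\pi z(q)_\infty}\exp\left(2\sum_{j\ge1}f_{k,j}(\tau)\frac{(2\pi iz)^j}{j!}\right).$$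
   Formalization: The claim is proved for j ≥ 2 only: for j = 0 the term B_j/(2j) is undefined, and for j = 1 symmetry under ζ ↦ ζ^{ -1} gives f_{k,1} = 0, so f_{k,1} + B_1/2 = ±1/4 is not an integer. -}

module Defs where

-- Formal (q, x)-expansions, where x = 2πiz, so ζ = e^x.
-- A series  Ser = ℕ → ℕ → ℚ  assigns to (n , j) the coefficient of q^n x^j.

open import Data.Bool using (Bool; true; false; if_then_else_)
open import Data.Nat as ℕ using (ℕ; zero; suc; _∸_; _≤ᵇ_; _≡ᵇ_; _!)
open import Data.Nat.Properties using (_!≢0)
open import Data.Integer as ℤ using (ℤ; +_; -[1+_]; ∣_∣)
open import Data.Rational using (ℚ; _/_; 0ℚ; 1ℚ; _+_; _*_; _-_; -_; ½)
open import Data.List using (List; []; _∷_; [_]; map; concatMap; applyUpTo; foldr)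
open import Relation.Nullary using (does)

sumTo : ℕ → (ℕ → ℚ) → ℚ
sumTo zero    f = 0ℚ
sumTo (suc n) f = sumTo n f + f n

sumList : List ℚ → ℚ
sumList = foldr _+_ 0ℚ

powQ : ℚ → ℕ → ℚ
powQ a zero    = 1ℚ
powQ a (suc m) = a * powQ a m

Ser : Set
Ser = ℕ → ℕ → ℚ

oneS : Ser
oneS zero zero = 1ℚ
oneS _    _    = 0ℚ

_⊕_ : Ser → Ser → Ser
(f ⊕ g) n j = f n j + g n j

_⊖_ : Ser → Ser → Ser
(f ⊖ g) n j = f n j - g n j

_⊗_ : Ser → Ser → Ser
(f ⊗ g) n j = sumTo (suc n) λ a → sumTo (suc j) λ b → f a b * g (n ∸ a) (j ∸ b)

infixl 6 _⊕_ _⊖_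
infixl 7 _⊗_

powS : Ser → ℕ → Ser
powS f zero    = oneS
powS f (suc m) = f ⊗ powS f m

prodTo : ℕ → (ℕ → Ser) → Ser
prodTo zero    F = oneS
prodTo (suc n) F = prodTo n F ⊗ F n

qpow : ℕ → Ser
qpow e n j = if e ≤ᵇ n then oneS (n ∸ e) j else 0ℚ

-- ζ^a = e^{a x}: coefficient of x^j is a^j / j!
expZ : ℤ → ℕ → ℚ
expZ a j = (a ℤ.^ j) / (j !)
  where instance _ = j !≢0

-- 1 / (1 - ζ^s q^m) = Σ_{r ≥ 0} ζ^{s r} q^{m r}   (used with m ≥ 1)
geo : ℤ → ℕ → Ser
geo s m n j = sumTo (suc n) λ r → if m ℕ.* r ≡ᵇ n then expZ (s ℤ.* + r) j else 0ℚ

pochInv : ℤ → ℕ → Ser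
pochInv s n = prodTo n λ i → geo s (suc i)

-- (q)_∞ : the coefficient of q^n only involves the factors (1 - q^m), m ≤ n
qPochInf : Ser
qPochInf n j = prodTo n (λ i → oneS ⊖ qpow (suc i)) n j

-- θ_{a,b}(τ) = Σ_{t ∈ ℤ} (-1)^t q^{(b t² + a t)/2}   (a, b ≥ 1; only |t| ≤ n can give q^n)
theta : ℕ → ℕ → Ser
theta a b n zero = sumTo (suc (2 ℕ.* n)) λ i →
  let t = + i ℤ.- + n in
  if does ((+ 2) ℤ.* (+ n) ℤ.≟ (+ b) ℤ.* t ℤ.* t ℤ.+ (+ a) ℤ.* t)
  then ((-[1+ 0 ] ℤ.^ ∣ t ∣) / 1) else 0ℚ
theta a b n (suc _) = 0ℚ

range : ℕ → ℕ → List ℕ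
range lo B = applyUpTo (lo ℕ.+_) (suc B ∸ lo)

chains : ℕ → ℕ → ℕ → List (List ℕ)
chains zero    lo B = [ [] ]
chains (suc L) lo B = concatMap (λ a → map (a ∷_) (chains L a B)) (range lo B)

sqSum : List ℕ → ℕ
sqSum l = foldr ℕ._+_ 0 (map (λ m → m ℕ.* m) l)

diffs : List ℕ → Ser
diffs (a ∷ b ∷ t) = pochInv (+ 0) (b ∸ a) ⊗ diffs (b ∷ t)
diffs _           = oneS

fgTerm : List ℕ → Ser
fgTerm []           = oneS
fgTerm (n₁ ∷ rest)  =
  qpow (sqSum (n₁ ∷ rest)) ⊗ pochInv (+ 1) n₁ ⊗ pochInv -[1+ 0 ] n₁ ⊗ diffs (n₁ ∷ rest)

-- FG_k(ζ, q): the coefficient of q^n only involves chains with n_{k-1} ≤ n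
FG : ℕ → Ser
FG k n j = sumList (map (λ c → fgTerm c n j) (chains (k ∸ 1) 1 n))

-- (q)_∞ FG_k + θ_{1,2k-1}   ( = (q)_∞ times the left-hand side of the defining identity )
Gser : ℕ → Ser
Gser k = theta 1 (2 ℕ.* k ∸ 1) ⊕ qPochInf ⊗ FG k

-- log(1 + F) = Σ_{p ≥ 1} (-1)^{p+1} F^p / p  for F with zero constant term;
-- F^p contributes nothing to q^n x^j once p > n + j.
log1p : Ser → Ser
log1p F n j = sumTo (n ℕ.+ j) λ m →
  ((-[1+ 0 ] ℤ.^ m) / suc m) * powS F (suc m) n j

-- sin(πz)/(πz) = (e^{x/2} - e^{-x/2}) / x  (independent of q)
sincSer : Ser
sincSer zero    j = (powQ ½ (suc j) - powQ (- ½) (suc j)) * ((+ 1) / (suc j !))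
  where instance _ = suc j !≢0
sincSer (suc _) j = 0ℚ

-- f_{k,j}: 2 Σ_j f_{k,j} x^j / j! = log( (q)_∞ (FG_k + θ/(q)_∞) / (sin(πz)/(πz)) )
-- fCoeff k j n = coefficient of q^n in f_{k,j}(τ)
fCoeff : ℕ → ℕ → ℕ → ℚ
fCoeff k j n = ((+ (j !)) / 2) * (log1p (Gser k ⊖ oneS) n j - log1p (sincSer ⊖ oneS) n j)

-- Bernoulli numbers, B₀ = 1, Σ_{i=0}^{m} C(m+1,i) B_i = 0 for m ≥ 1 (so B₁ = -1/2)
open import Data.Nat.Combinatorics using (_C_)

bernUpTo : ℕ → ℕ → ℚ
bernUpTo zero    i = 1ℚ
bernUpTo (suc m) i =
  if i ≤ᵇ m then bernUpTo m i
  else - (((+ 1) / (suc (suc m))) * sumTo (suc m) λ l → ((+ (suc (suc m) C l)) / 1) * bernUpTo m l)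

bernoulli : ℕ → ℚ
bernoulli m = bernUpTo m m

-- 1 / (2j)  (0 for j = 0, never used there)
inv2j : ℕ → ℚ
inv2j zero    = 0ℚ
inv2j (suc i) = (+ 1) / (2 ℕ.* suc i)

shiftedCoeff : ℕ → ℕ → ℕ → ℚ
shiftedCoeff k j zero    = fCoeff k j zero + bernoulli j * inv2j j
shiftedCoeff k j (suc n) = fCoeff k j (suc n)

{-# OPTIONS --safe #-}

-- Let D = d/dx. Call a series in q and x integral if all the numbers j! [qⁿ xʲ] are integers, and even if moreover
-- they are divisible by 2 for j ≥ 1, that is, if D of the series is twice an integral one. Both kinds form rings, by
-- the Leibniz rule. The series G = (q)_∞ FG_k + θ_{1,2k-1} is even: modulo 2 the substitution ζ ↦ ζ⁻¹ acts trivially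
-- on integral series in q and ζ, so D (P(ζ) P(ζ⁻¹)) ≡ D (P(ζ)²) = 2 P(ζ) D P(ζ) for the Pochhammer factors. Hence
-- D log G = Σ_m (-1)^m (G - 1)^m D G is divisible by 2, which settles the coefficients of qⁿ with n ≥ 1.
-- For n = 0 only sinc = (e^{x/2} - e^{-x/2})/x contributes. Put u = e^{x/2} sinc = (e^x - 1)/x, so that
-- sinc′/sinc = u′/u - 1/2. The recurrence of the Bernoulli numbers says that β = Σ B_l x^l/l! satisfies β u = 1,
-- whence ((β - 1)/x + 1) u = u′; thus the coefficients of log sinc beyond x are B_j/(j · j!).

module Submission where

open import Defs
open import Algebra.Bundles using (CommutativeRing)
open import Algebra.Structures using (IsCommutativeRing)
open import Data.Bool using (true; false; if_then_else_; T)
open import Data.Integer as ℤ using (ℤ; +_; -[1+_])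
import Data.Integer.Properties as ℤ
open import Data.Integer.Solver using () renaming (module +-*-Solver to ℤ-Solver)
open import Data.List using ([]; _∷_; map)
open import Data.Nat as ℕ using (ℕ; zero; suc; _∸_; _≤_; _≤ᵇ_; _≡ᵇ_; _!; s≤s; z≤n)
open import Data.Nat.Combinatorics using (_C_; nCk≡n!/k![n-k]!; k![n∸k]!∣n!; nC1≡n; nCk≡nC[n∸k])
open import Data.Nat.DivMod using (m/n*n≡m)
import Data.Nat.Properties as ℕ
open import Data.Product using (∃; _,_; proj₁; proj₂)
open import Function using (_∘_)
open import Level using (_⊔_)
open import Relation.Nullary using (does)
open import Relation.Nullary.Decidable using (dec-true)

-- Power series over a commutative ring

module PowerSeries {c ℓ} (R : CommutativeRing c ℓ) where
  open CommutativeRing R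
  open import Algebra.Solver.Ring.NaturalCoefficients.Default commutativeSemiring
  open import Relation.Binary.Reasoning.Setoid setoid

  Series : Set c
  Series = ℕ → Carrier

  infix 4 _≋_
  infixl 7 _∗_

  _≋_ : Series → Series → Set ℓ
  f ≋ g = ∀ n → f n ≈ g n

  tail : Series → Series
  tail f = f ∘ suc

  0s : Series
  0s _ = 0#

  1s : Series
  1s zero    = 1#
  1s (suc _) = 0#

  -- The Cauchy product, by recursion on the tail of the left factor instead of a sum over the
  -- splittings of `n`: the ring laws become inductions without subtraction of indices.
  _∗_ : Series → Series → Series
  (f ∗ g) zero    = f 0 * g 0
  (f ∗ g) (suc n) = f 0 * g (suc n) + (tail f ∗ g) n

  -- The bounded form serves factors that are known only up to some degree, such as truncated sums.
  ∗-cong-≤ : ∀ {f f′ g g′} n → (∀ i → i ℕ.≤ n → f i ≈ f′ i) → (∀ i → i ℕ.≤ n → g i ≈ g′ i) →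
             (f ∗ g) n ≈ (f′ ∗ g′) n
  ∗-cong-≤ zero    p q = *-cong (p 0 z≤n) (q 0 z≤n)
  ∗-cong-≤ (suc n) p q =
    +-cong (*-cong (p 0 z≤n) (q (suc n) ℕ.≤-refl))
           (∗-cong-≤ n (λ i i≤n → p (suc i) (s≤s i≤n)) (λ i i≤n → q i (ℕ.m≤n⇒m≤1+n i≤n)))

  ∗-cong : ∀ {f f′ g g′} → f ≋ f′ → g ≋ g′ → f ∗ g ≋ f′ ∗ g′
  ∗-cong p q n = ∗-cong-≤ n (λ i _ → p i) (λ i _ → q i)

  ∗-zeroˡ : ∀ g → 0s ∗ g ≋ 0s
  ∗-zeroˡ g zero    = zeroˡ _
  ∗-zeroˡ g (suc n) = trans (+-cong (zeroˡ _) (∗-zeroˡ g n)) (+-identityʳ _)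

  ∗-distribʳ : ∀ h f g → (λ i → f i + g i) ∗ h ≋ (λ i → (f ∗ h) i + (g ∗ h) i)
  ∗-distribʳ h f g zero    = distribʳ _ _ _
  ∗-distribʳ h f g (suc n) = trans (+-congˡ (∗-distribʳ h (tail f) (tail g) n))
    (solve 5 (λ a b c x y → (a :+ b) :* c :+ (x :+ y) := (a :* c :+ x) :+ (b :* c :+ y)) refl
      (f 0) (g 0) (h (suc n)) ((tail f ∗ h) n) ((tail g ∗ h) n))

  ∗-scaleˡ : ∀ a f g → (λ i → a * f i) ∗ g ≋ (λ i → a * (f ∗ g) i)
  ∗-scaleˡ a f g zero    = *-assoc _ _ _
  ∗-scaleˡ a f g (suc n) = trans (+-cong (*-assoc _ _ _) (∗-scaleˡ a (tail f) g n)) (sym (distribˡ _ _ _))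

  ∗-assoc : ∀ f g h → (f ∗ g) ∗ h ≋ f ∗ (g ∗ h)
  ∗-assoc f g h zero    = *-assoc _ _ _
  ∗-assoc f g h (suc n) = begin
    f 0 * g 0 * h (suc n) + ((λ i → f 0 * g (suc i) + (tail f ∗ g) i) ∗ h) n
      ≈⟨ +-congˡ (∗-distribʳ h _ _ n) ⟩
    f 0 * g 0 * h (suc n) + (((λ i → f 0 * g (suc i)) ∗ h) n + ((tail f ∗ g) ∗ h) n)
      ≈⟨ +-congˡ (+-cong (∗-scaleˡ (f 0) (tail g) h n) (∗-assoc (tail f) g h n)) ⟩
    f 0 * g 0 * h (suc n) + (f 0 * (tail g ∗ h) n + (tail f ∗ (g ∗ h)) n)
      ≈⟨ solve 5 (λ a b c x y → a :* b :* c :+ (a :* x :+ y) := a :* (b :* c :+ x) :+ y) refl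
           (f 0) (g 0) (h (suc n)) ((tail g ∗ h) n) ((tail f ∗ (g ∗ h)) n) ⟩
    f 0 * (g ∗ h) (suc n) + (tail f ∗ (g ∗ h)) n ∎

  -- The mirror image of the defining recursion. It drives commutativity, and for `g 0 = 0` it says
  -- that dividing `g` by the variable divides the product.
  ∗-sucʳ : ∀ f g n → (f ∗ g) (suc n) ≈ (f ∗ tail g) n + f (suc n) * g 0
  ∗-sucʳ f g zero    = refl
  ∗-sucʳ f g (suc n) = trans (+-congˡ (∗-sucʳ (tail f) g n)) (sym (+-assoc _ _ _))

  ∗-comm : ∀ f g → f ∗ g ≋ g ∗ f
  ∗-comm f g zero    = *-comm _ _
  ∗-comm f g (suc n) = begin
    f 0 * g (suc n) + (tail f ∗ g) n ≈⟨ +-cong (*-comm _ _) (∗-comm (tail f) g n) ⟩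
    g (suc n) * f 0 + (g ∗ tail f) n ≈⟨ +-comm _ _ ⟩
    (g ∗ tail f) n + g (suc n) * f 0 ≈⟨ ∗-sucʳ g f n ⟨
    (g ∗ f) (suc n) ∎

  ∗-identityˡ : ∀ f → 1s ∗ f ≋ f
  ∗-identityˡ f zero    = *-identityˡ _
  ∗-identityˡ f (suc n) = trans (+-cong (*-identityˡ _) (∗-zeroˡ f n)) (+-identityʳ _)

  ∗-distribˡ : ∀ h f g → h ∗ (λ i → f i + g i) ≋ (λ i → (h ∗ f) i + (h ∗ g) i)
  ∗-distribˡ h f g n = trans (∗-comm h _ n) (trans (∗-distribʳ h f g n) (+-cong (∗-comm f h n) (∗-comm g h n)))

  ∗-isCommutativeRing : IsCommutativeRing _≋_ (λ f g i → f i + g i) _∗_ (λ f i → - f i) 0s 1s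
  ∗-isCommutativeRing = record
    { isRing = record
      { +-isAbelianGroup = record
        { isGroup = record
          { isMonoid = record
            { isSemigroup = record
              { isMagma = record
                { isEquivalence = record
                  { refl  = λ _ → refl
                  ; sym   = λ p n → sym (p n)
                  ; trans = λ p q n → trans (p n) (q n) }
                ; ∙-cong = λ p q n → +-cong (p n) (q n) }
              ; assoc = λ f g h n → +-assoc _ _ _ }
            ; identity = (λ f n → +-identityˡ _) , (λ f n → +-identityʳ _) }
          ; inverse = (λ f n → -‿inverseˡ _) , (λ f n → -‿inverseʳ _)
          ; ⁻¹-cong = λ p n → -‿cong (p n) }
        ; comm = λ f g n → +-comm _ _ }
      ; *-cong = ∗-cong
      ; *-assoc = ∗-assoc
      ; *-identity = ∗-identityˡ , (λ f n → trans (∗-comm f 1s n) (∗-identityˡ f n))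
      ; distrib = ∗-distribˡ , ∗-distribʳ }
    ; *-comm = ∗-comm }

  ∗-commutativeRing : CommutativeRing c ℓ
  ∗-commutativeRing = record { isCommutativeRing = ∗-isCommutativeRing }

-- Derivations

record Derivation {c ℓ} (R : CommutativeRing c ℓ) : Set (c ⊔ ℓ) where
  open CommutativeRing R
  field
    δ       : Carrier → Carrier
    δ-cong  : ∀ {x y} → x ≈ y → δ x ≈ δ y
    δ-+     : ∀ x y → δ (x + y) ≈ δ x + δ y
    leibniz : ∀ x y → δ (x * y) ≈ δ x * y + x * δ y

module DerivationProperties {c ℓ} {R : CommutativeRing c ℓ} (d : Derivation R) where
  open CommutativeRing R
  open Derivation d
  open import Algebra.Solver.Ring.NaturalCoefficients.Default commutativeSemiring
  open import Algebra.Properties.Semiring.Mult semiring using (_×_; ×-congʳ; ×-comm-*)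
  open import Relation.Binary.Reasoning.Setoid setoid

  infixr 8 _^_
  -- The recursion is that of `powS`, so that `powS-^` can compare the two powers step by step.
  _^_ : Carrier → ℕ → Carrier
  x ^ zero  = 1#
  x ^ suc m = x * x ^ m

  δ-^ : ∀ x m → δ (x ^ suc m) ≈ suc m × (x ^ m * δ x)
  δ-^ x zero = begin
    δ (x * 1#) ≈⟨ δ-cong (*-identityʳ x) ⟩
    δ x        ≈⟨ *-identityˡ (δ x) ⟨
    1# * δ x   ≈⟨ +-identityʳ _ ⟨
    1# * δ x + 0# ∎
  δ-^ x (suc m) = begin
    δ (x * x ^ suc m)                             ≈⟨ leibniz _ _ ⟩
    δ x * x ^ suc m + x * δ (x ^ suc m)           ≈⟨ +-cong (*-comm _ _) (*-congˡ (δ-^ x m)) ⟩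
    x ^ suc m * δ x + x * (suc m × (x ^ m * δ x)) ≈⟨ +-congˡ (×-comm-* (suc m) _ _) ⟩
    x ^ suc m * δ x + suc m × (x * (x ^ m * δ x)) ≈⟨ +-congˡ (×-congʳ (suc m) (sym (*-assoc _ _ _))) ⟩
    x ^ suc m * δ x + suc m × (x ^ suc m * δ x) ∎

  *-expand : ∀ a e a′ e′ → (a + e) * (a′ + e′) ≈ a * a′ + ((a * e′ + e * a′) + e * e′)
  *-expand = solve 4 (λ a e a′ e′ → (a :+ e) :* (a′ :+ e′) := a :* a′ :+ ((a :* e′ :+ e :* a′) :+ e :* e′)) refl

  -- Modulo 2 this is the derivative of a square: the first bracket is a double, and each term of
  -- the second contains `e` or `δ e`.
  δ-near-square : ∀ a e → δ (a * (a + e)) ≈ (a * δ a + a * δ a) + (δ a * e + a * δ e)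
  δ-near-square a e = begin
    δ (a * (a + e))               ≈⟨ leibniz _ _ ⟩
    δ a * (a + e) + a * δ (a + e) ≈⟨ +-congˡ (*-congˡ (δ-+ a e)) ⟩
    δ a * (a + e) + a * (δ a + δ e)
      ≈⟨ solve 4 (λ a e a′ e′ → a′ :* (a :+ e) :+ a :* (a′ :+ e′) := (a :* a′ :+ a :* a′) :+ (a′ :* e :+ a :* e′))
           refl a e (δ a) (δ e) ⟩
    (a * δ a + a * δ a) + (δ a * e + a * δ e) ∎

module _ {c ℓ} {R : CommutativeRing c ℓ} (d : Derivation R) where
  open CommutativeRing R
  open Derivation d
  open PowerSeries R using (_∗_; tail; ∗-commutativeRing)
  open import Algebra.Solver.Ring.NaturalCoefficients.Default commutativeSemiring

  leibniz-∗ : ∀ f g n → δ ((f ∗ g) n) ≈ ((δ ∘ f) ∗ g) n + (f ∗ (δ ∘ g)) n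
  leibniz-∗ f g zero    = leibniz _ _
  leibniz-∗ f g (suc n) = trans (δ-+ _ _) (trans (+-cong (leibniz _ _) (leibniz-∗ (tail f) g n))
    (solve 4 (λ a b x y → (a :+ b) :+ (x :+ y) := (a :+ x) :+ (b :+ y)) refl
      (δ (f 0) * g (suc n)) (f 0 * δ (g (suc n))) _ _))

  -- Applied to d/dx on series in x, this yields the partial derivative `∂` on series in q and x.
  coefficientwise : Derivation ∗-commutativeRing
  coefficientwise = record
    { δ       = λ f n → δ (f n)
    ; δ-cong  = λ p n → δ-cong (p n)
    ; δ-+     = λ f g n → δ-+ _ _
    ; leibniz = leibniz-∗ }

open import Data.Rational using (ℚ; _/_; 0ℚ; 1ℚ; _+_; _*_; _-_; -_; ½; fromℚᵘ; toℚᵘ)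
open import Data.Rational.Properties as ℚ using (toℚᵘ-injective; toℚᵘ-homo-+; toℚᵘ-homo-*; toℚᵘ-fromℚᵘ; fromℚᵘ-cong)
open import Data.Rational.Solver
open import Data.Rational.Unnormalised as ℚᵘ using (mkℚᵘ; *≡*)
import Data.Rational.Unnormalised.Properties as ℚᵘ
open import Algebra.Properties.Group ℚ.+-0-group using () renaming (∙-cancelˡ to +-cancelˡ)
open import Relation.Binary.PropositionalEquality
open +-*-Solver using (solve; _:=_; con) renaming (_:+_ to _⊞_; _:*_ to _⊠_; :-_ to ⊟_; _:-_ to _⊟′_)

-- Integers, fractions and inverse factorials in ℚ

fromℚᵘ-+ : ∀ p q → fromℚᵘ p + fromℚᵘ q ≡ fromℚᵘ (p ℚᵘ.+ q)
fromℚᵘ-+ p q = toℚᵘ-injective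
  (ℚᵘ.≃-trans (toℚᵘ-homo-+ (fromℚᵘ p) (fromℚᵘ q))
  (ℚᵘ.≃-trans (ℚᵘ.+-cong (toℚᵘ-fromℚᵘ p) (toℚᵘ-fromℚᵘ q))
              (ℚᵘ.≃-sym (toℚᵘ-fromℚᵘ (p ℚᵘ.+ q)))))

fromℚᵘ-* : ∀ p q → fromℚᵘ p * fromℚᵘ q ≡ fromℚᵘ (p ℚᵘ.* q)
fromℚᵘ-* p q = toℚᵘ-injective
  (ℚᵘ.≃-trans (toℚᵘ-homo-* (fromℚᵘ p) (fromℚᵘ q))
  (ℚᵘ.≃-trans (ℚᵘ.*-cong (toℚᵘ-fromℚᵘ p) (toℚᵘ-fromℚᵘ q))
              (ℚᵘ.≃-sym (toℚᵘ-fromℚᵘ (p ℚᵘ.* q)))))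

ι : ℤ → ℚ
ι z = z / 1

ν : ℕ → ℚ
ν n = ι (+ n)

ι-+ : ∀ a b → ι (a ℤ.+ b) ≡ ι a + ι b
ι-+ a b = sym (trans (fromℚᵘ-+ (mkℚᵘ a 0) (mkℚᵘ b 0))
  (cong ι (cong₂ ℤ._+_ (ℤ.*-identityʳ a) (ℤ.*-identityʳ b))))

ι-* : ∀ a b → ι (a ℤ.* b) ≡ ι a * ι b
ι-* a b = sym (fromℚᵘ-* (mkℚᵘ a 0) (mkℚᵘ b 0))

ι-neg : ∀ a → ι (ℤ.- a) ≡ - ι a
ι-neg (+ zero)   = refl
ι-neg (+ suc n)  = refl
ι-neg -[1+ n ]   = sym (solve 1 (λ x → ⊟ (⊟ x) := x) refl (ν (suc n)))

ν-suc : ∀ n → ν (suc n) ≡ 1ℚ + ν n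
ν-suc n = ι-+ (+ 1) (+ n)

ν-* : ∀ m n → ν (m ℕ.* n) ≡ ν m * ν n
ν-* m n = trans (cong ι (ℤ.pos-* m n)) (ι-* (+ m) (+ n))

-- `z / suc d` unfolds to `fromℚᵘ (mkℚᵘ z d)`, so the equation can be checked on unnormalised
-- fractions.
/-cancel : ∀ z n .{{_ : ℕ.NonZero n}} → (z / n) * ν n ≡ ι z
/-cancel z (suc d) = trans (fromℚᵘ-* (mkℚᵘ z d) (mkℚᵘ (+ suc d) 0))
  (fromℚᵘ-cong {mkℚᵘ z d ℚᵘ.* mkℚᵘ (+ suc d) 0} {mkℚᵘ z 0}
    (*≡* (trans (ℤ.*-identityʳ _) (cong (λ m → z ℤ.* (+ suc m)) (sym (ℕ.*-identityʳ d))))))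

1/-cancel : ∀ n .{{_ : ℕ.NonZero n}} → ((+ 1) / n) * ν n ≡ 1ℚ
1/-cancel n = /-cancel (+ 1) n

ν-cancelʳ : ∀ n .{{_ : ℕ.NonZero n}} {x y} → x * ν n ≡ y * ν n → x ≡ y
ν-cancelʳ n {x} {y} eq = begin
  x                     ≡⟨ lem x ⟨
  x * ν n * ((+ 1) / n) ≡⟨ cong (_* ((+ 1) / n)) eq ⟩
  y * ν n * ((+ 1) / n) ≡⟨ lem y ⟩
  y ∎
  where
  open ≡-Reasoning
  lem : ∀ w → w * ν n * ((+ 1) / n) ≡ w
  lem w = trans (solve 3 (λ w a b → w ⊠ a ⊠ b := w ⊠ (b ⊠ a)) refl w (ν n) ((+ 1) / n))
                (trans (cong (w *_) (1/-cancel n)) (ℚ.*-identityʳ w))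

infix 9 _!⁻¹
_!⁻¹ : ℕ → ℚ
n !⁻¹ = (+ 1) / (n !)
  where instance _ = n ℕ.!≢0

!⁻¹-cancel : ∀ n → n !⁻¹ * ν (n !) ≡ 1ℚ
!⁻¹-cancel n = 1/-cancel (n !)
  where instance _ = n ℕ.!≢0

!⁻¹-suc : ∀ n → ν (suc n) * suc n !⁻¹ ≡ n !⁻¹
!⁻¹-suc n = ν-cancelʳ (n !) (begin
  ν (suc n) * suc n !⁻¹ * ν (n !)   ≡⟨ solve 3 (λ a b c → a ⊠ b ⊠ c := b ⊠ (a ⊠ c)) refl (ν (suc n)) (suc n !⁻¹) (ν (n !)) ⟩
  suc n !⁻¹ * (ν (suc n) * ν (n !)) ≡⟨ cong (suc n !⁻¹ *_) (ν-* (suc n) (n !)) ⟨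
  suc n !⁻¹ * ν (suc n !)           ≡⟨ !⁻¹-cancel (suc n) ⟩
  1ℚ                                ≡⟨ !⁻¹-cancel n ⟨
  n !⁻¹ * ν (n !) ∎)
  where
  open ≡-Reasoning
  instance _ = n ℕ.!≢0

ν!-suc : ∀ n → ν (suc n !) ≡ ν (n !) * ν (suc n)
ν!-suc n = trans (ν-* (suc n) (n !)) (ℚ.*-comm (ν (suc n)) (ν (n !)))

-- Finite sums

sumTo-cong : ∀ n {f g} → (∀ i → f i ≡ g i) → sumTo n f ≡ sumTo n g
sumTo-cong zero    p = refl
sumTo-cong (suc n) p = cong₂ _+_ (sumTo-cong n p) (p n)

sumTo-zero : ∀ n {f} → (∀ i → f i ≡ 0ℚ) → sumTo n f ≡ 0ℚ
sumTo-zero zero    p = refl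
sumTo-zero (suc n) p = cong₂ _+_ (sumTo-zero n p) (p n)

sumTo-+ : ∀ n f g → sumTo n (λ i → f i + g i) ≡ sumTo n f + sumTo n g
sumTo-+ zero    f g = refl
sumTo-+ (suc n) f g = trans (cong (_+ (f n + g n)) (sumTo-+ n f g))
  (solve 4 (λ a b c d → (a ⊞ b) ⊞ (c ⊞ d) := (a ⊞ c) ⊞ (b ⊞ d)) refl (sumTo n f) (sumTo n g) (f n) (g n))

sumTo-head : ∀ n f → sumTo (suc n) f ≡ f 0 + sumTo n (f ∘ suc)
sumTo-head zero    f = ℚ.+-comm 0ℚ (f 0)
sumTo-head (suc n) f = trans (cong (_+ f (suc n)) (sumTo-head n f)) (ℚ.+-assoc (f 0) _ (f (suc n)))

-- Rows are the power series in x over ℚ, and Ser is the ring of power series in q over the rows.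

module Row = PowerSeries ℚ.+-*-commutativeRing
module Ser₂ = PowerSeries Row.∗-commutativeRing

open Row using (_∗_; tail; 1s)

∗-sumTo : ∀ n s t → sumTo (suc n) (λ a → s a * t (n ∸ a)) ≡ (s ∗ t) n
∗-sumTo zero    s t = ℚ.+-identityˡ (s 0 * t 0)
∗-sumTo (suc n) s t = trans (sumTo-head (suc n) _) (cong (_+_ (s 0 * t (suc n))) (∗-sumTo n (tail s) t))

-- Peeling the first summand off the sum over powers of q gives the recursion of the product, and
-- `∗-sumTo` treats each row. All ring laws for `_⊗_` are borrowed through this bridge.
⊗-∗ : ∀ f g n j → (f ⊗ g) n j ≡ (f Ser₂.∗ g) n j
⊗-∗ f g zero    j = trans (ℚ.+-identityˡ _) (∗-sumTo j (f 0) (g 0))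
⊗-∗ f g (suc n) j = trans (sumTo-head (suc n) _)
  (cong₂ _+_ (∗-sumTo j (f 0) (g (suc n))) (⊗-∗ (f ∘ suc) g n j))

oneS-1s : ∀ n j → oneS n j ≡ Ser₂.1s n j
oneS-1s zero    zero    = refl
oneS-1s zero    (suc j) = refl
oneS-1s (suc n) j       = refl

-- Differentiation in x

θ : (ℕ → ℚ) → ℕ → ℚ
θ s j = ν j * s j

-- `θ` is the Euler operator x d/dx. It preserves degrees, so its Leibniz rule goes by induction
-- along the product; the rule for `D` then follows on division by x.
θ-∗ : ∀ s t n → θ (s ∗ t) n ≡ (θ s ∗ t) n + (s ∗ θ t) n
θ-∗ s t zero    = solve 2 (λ a b → con 0ℚ ⊠ (a ⊠ b) := (con 0ℚ ⊠ a) ⊠ b ⊞ a ⊠ (con 0ℚ ⊠ b)) refl (s 0) (t 0)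
θ-∗ s t (suc n) = begin
  N * (s 0 * t (suc n) + X)
    ≡⟨ ℚ.*-distribˡ-+ N (s 0 * t (suc n)) X ⟩
  N * (s 0 * t (suc n)) + N * X
    ≡⟨ cong (λ z → N * (s 0 * t (suc n)) + z) (trans (cong (_* X) (ν-suc n)) (solve 2 (λ n x → (con 1ℚ ⊞ n) ⊠ x := x ⊞ n ⊠ x) refl (ν n) X)) ⟩
  N * (s 0 * t (suc n)) + (X + θ (tail s ∗ t) n)
    ≡⟨ cong (λ z → N * (s 0 * t (suc n)) + (X + z)) (θ-∗ (tail s) t n) ⟩
  N * (s 0 * t (suc n)) + (X + (Y + Z))
    ≡⟨ solve 6 (λ a b c x y z → c ⊠ (a ⊠ b) ⊞ (x ⊞ (y ⊞ z)) := ((con 0ℚ ⊠ a) ⊠ b ⊞ (x ⊞ y)) ⊞ (a ⊠ (c ⊠ b) ⊞ z)) refl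
         (s 0) (t (suc n)) N X Y Z ⟩
  (0ℚ * s 0 * t (suc n) + (X + Y)) + (s 0 * (N * t (suc n)) + Z)
    ≡⟨ cong (λ z → (0ℚ * s 0 * t (suc n) + z) + (s 0 * (N * t (suc n)) + Z)) tail-θ ⟨
  (0ℚ * s 0 * t (suc n) + (tail (θ s) ∗ t) n) + (s 0 * (N * t (suc n)) + Z) ∎
  where
  open ≡-Reasoning
  N = ν (suc n)
  X = (tail s ∗ t) n
  Y = (θ (tail s) ∗ t) n
  Z = (tail s ∗ θ t) n
  -- With `h = tail s` this is x d/dx (x h) = x (h + x d/dx h), divided by x.
  tail-θ : (tail (θ s) ∗ t) n ≡ X + Y
  tail-θ = trans (Row.∗-cong {tail (θ s)} {λ i → tail s i + θ (tail s) i} {t} {t}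
      (λ i → trans (cong (_* s (suc i)) (ν-suc i))
        (solve 2 (λ n x → (con 1ℚ ⊞ n) ⊠ x := x ⊞ n ⊠ x) refl (ν i) (s (suc i)))) (λ _ → refl) n)
    (Row.∗-distribʳ t (tail s) (θ (tail s)) n)

-- The derivative d/dx, as the Euler operator divided by x.
D : (ℕ → ℚ) → ℕ → ℚ
D s = tail (θ s)

D-∗ : ∀ s t n → D (s ∗ t) n ≡ (D s ∗ t) n + (s ∗ D t) n
D-∗ s t n = begin
  θ (s ∗ t) (suc n)                     ≡⟨ θ-∗ s t (suc n) ⟩
  (θ s ∗ t) (suc n) + (s ∗ θ t) (suc n) ≡⟨ cong (_+_ ((θ s ∗ t) (suc n))) (Row.∗-sucʳ s (θ t) n) ⟩
  (0ℚ * s 0 * t (suc n) + (D s ∗ t) n) + ((s ∗ D t) n + s (suc n) * (0ℚ * t 0))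
    ≡⟨ solve 6 (λ a b x y c d → (con 0ℚ ⊠ a ⊠ b ⊞ x) ⊞ (y ⊞ c ⊠ (con 0ℚ ⊠ d)) := x ⊞ y) refl
         (s 0) (t (suc n)) ((D s ∗ t) n) ((s ∗ D t) n) (s (suc n)) (t 0) ⟩
  (D s ∗ t) n + (s ∗ D t) n ∎
  where open ≡-Reasoning

derivation : Derivation Row.∗-commutativeRing
derivation = record
  { δ       = D
  ; δ-cong  = λ p j → cong (ν (suc j) *_) (p (suc j))
  ; δ-+     = λ s t j → ℚ.*-distribˡ-+ (ν (suc j)) (s (suc j)) (t (suc j))
  ; leibniz = D-∗ }

∂ : Ser → Ser
∂ f n = D (f n)

module ∂-Properties = DerivationProperties (coefficientwise derivation)
open ∂-Properties using (_^_)

powS-^ : ∀ f m n j → powS f m n j ≡ (f ^ m) n j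
powS-^ f zero    = oneS-1s
powS-^ f (suc m) n j = trans (⊗-∗ f (powS f m) n j)
  (Ser₂.∗-cong {f} {f} {powS f m} {f ^ m} (λ _ _ → refl) (powS-^ f m) n j)

⊗-cong : ∀ {f f′ g g′} → (∀ n j → f n j ≡ f′ n j) → (∀ n j → g n j ≡ g′ n j) → ∀ n j → (f ⊗ g) n j ≡ (f′ ⊗ g′) n j
⊗-cong {f} {f′} {g} {g′} p q n j =
  trans (⊗-∗ f g n j) (trans (Ser₂.∗-cong {f} {f′} {g} {g′} p q n j) (sym (⊗-∗ f′ g′ n j)))

⊗-assoc : ∀ f g h n j → ((f ⊗ g) ⊗ h) n j ≡ (f ⊗ (g ⊗ h)) n j
⊗-assoc f g h n j = begin
  ((f ⊗ g) ⊗ h) n j           ≡⟨ ⊗-cong {f ⊗ g} {f Ser₂.∗ g} {h} (⊗-∗ f g) (λ _ _ → refl) n j ⟩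
  ((f Ser₂.∗ g) ⊗ h) n j      ≡⟨ ⊗-∗ (f Ser₂.∗ g) h n j ⟩
  ((f Ser₂.∗ g) Ser₂.∗ h) n j ≡⟨ Ser₂.∗-assoc f g h n j ⟩
  (f Ser₂.∗ (g Ser₂.∗ h)) n j ≡⟨ ⊗-∗ f (g Ser₂.∗ h) n j ⟨
  (f ⊗ (g Ser₂.∗ h)) n j      ≡⟨ ⊗-cong {f} {f} {g ⊗ h} (λ _ _ → refl) (⊗-∗ g h) n j ⟨
  (f ⊗ (g ⊗ h)) n j ∎
  where open ≡-Reasoning

-- Integrality

infix 4 _∣ℚ_
-- For `d = 1` this is integrality.
record _∣ℚ_ (d : ℕ) (q : ℚ) : Set where
  constructor divides
  field
    quotient : ℤ
    equality : q ≡ ν d * ι quotient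

∣ℚ-+ : ∀ {d p q} → d ∣ℚ p → d ∣ℚ q → d ∣ℚ p + q
∣ℚ-+ {d} (divides a refl) (divides b refl) =
  divides (a ℤ.+ b) (trans (sym (ℚ.*-distribˡ-+ (ν d) (ι a) (ι b))) (cong (ν d *_) (sym (ι-+ a b))))

∣ℚ-neg : ∀ {d p} → d ∣ℚ p → d ∣ℚ - p
∣ℚ-neg {d} (divides a refl) =
  divides (ℤ.- a) (trans (ℚ.neg-distribʳ-* (ν d) (ι a)) (cong (ν d *_) (sym (ι-neg a))))

∣ℚ-* : ∀ {d e p q} → d ∣ℚ p → e ∣ℚ q → d ℕ.* e ∣ℚ p * q
∣ℚ-* {d} {e} (divides a refl) (divides b refl) = divides (a ℤ.* b) (begin
  (ν d * ι a) * (ν e * ι b) ≡⟨ solve 4 (λ d a e b → (d ⊠ a) ⊠ (e ⊠ b) := (d ⊠ e) ⊠ (a ⊠ b)) refl (ν d) (ι a) (ν e) (ι b) ⟩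
  (ν d * ν e) * (ι a * ι b) ≡⟨ cong₂ _*_ (ν-* d e) (ι-* a b) ⟨
  ν (d ℕ.* e) * ι (a ℤ.* b) ∎)
  where open ≡-Reasoning

∣ℚ-zero : ∀ {d} → d ∣ℚ 0ℚ
∣ℚ-zero {d} = divides (+ 0) (sym (ℚ.*-zeroʳ (ν d)))

∣ℚ-sumTo : ∀ {d} n {f} → (∀ i → d ∣ℚ f i) → d ∣ℚ sumTo n f
∣ℚ-sumTo zero    p = ∣ℚ-zero
∣ℚ-sumTo (suc n) p = ∣ℚ-+ (∣ℚ-sumTo n p) (p n)

1∣ℚ-ι : ∀ z → 1 ∣ℚ ι z
1∣ℚ-ι z = divides z (sym (ℚ.*-identityˡ (ι z)))

2∣ℚ⇒1∣ℚ : ∀ {q} → 2 ∣ℚ q → 1 ∣ℚ q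
2∣ℚ⇒1∣ℚ (divides z refl) = divides (+ 2 ℤ.* z) (trans (sym (ι-* (+ 2) z)) (sym (ℚ.*-identityˡ _)))

2∣ℚ-double : ∀ {q} → 1 ∣ℚ q → 2 ∣ℚ q + q
2∣ℚ-double (divides z refl) =
  divides z (solve 1 (λ z → con 1ℚ ⊠ z ⊞ con 1ℚ ⊠ z := con (ν 2) ⊠ z) refl (ι z))

-- `s` is the exponential generating function of a sequence of integers divisible by `d`. For
-- instance, ζ^a belongs to the sequence of powers of `a`.
record EGF (d : ℕ) (s : ℕ → ℚ) : Set where
  field
    coeff-∣ : ∀ j → d ∣ℚ ν (j !) * s j
open EGF

EGF-cong : ∀ {d s t} → (∀ j → s j ≡ t j) → EGF d s → EGF d t
EGF-cong {d} p h .coeff-∣ j = subst (λ q → d ∣ℚ ν (j !) * q) (p j) (h .coeff-∣ j)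

EGF-zero : ∀ {d} → EGF d (λ _ → 0ℚ)
EGF-zero {d} .coeff-∣ j = subst (d ∣ℚ_) (sym (ℚ.*-zeroʳ (ν (j !)))) ∣ℚ-zero

EGF-+ : ∀ {d s t} → EGF d s → EGF d t → EGF d (λ j → s j + t j)
EGF-+ {d} {s} {t} p q .coeff-∣ j =
  subst (d ∣ℚ_) (sym (ℚ.*-distribˡ-+ (ν (j !)) (s j) (t j))) (∣ℚ-+ (p .coeff-∣ j) (q .coeff-∣ j))

EGF-neg : ∀ {d s} → EGF d s → EGF d (λ j → - s j)
EGF-neg {d} {s} p .coeff-∣ j = subst (d ∣ℚ_) (ℚ.neg-distribʳ-* (ν (j !)) (s j)) (∣ℚ-neg (p .coeff-∣ j))

EGF-2⇒1 : ∀ {s} → EGF 2 s → EGF 1 s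
EGF-2⇒1 p .coeff-∣ j = 2∣ℚ⇒1∣ℚ (p .coeff-∣ j)

EGF-double : ∀ {s} → EGF 1 s → EGF 2 (λ j → s j + s j)
EGF-double {s} p .coeff-∣ j =
  subst (2 ∣ℚ_) (sym (ℚ.*-distribˡ-+ (ν (j !)) (s j) (s j))) (2∣ℚ-double (p .coeff-∣ j))

!-D : ∀ s j → ν (j !) * D s j ≡ ν (suc j !) * s (suc j)
!-D s j = trans (sym (ℚ.*-assoc (ν (j !)) (ν (suc j)) (s (suc j)))) (cong (_* s (suc j)) (sym (ν!-suc j)))

EGF-D : ∀ {d s} → EGF d s → EGF d (D s)
EGF-D {d} {s} p .coeff-∣ j = subst (d ∣ℚ_) (sym (!-D s j)) (p .coeff-∣ (suc j))

-- The Leibniz rule replaces the binomial convolution of the numbers j! s_j.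
EGF-∗ : ∀ {d e s t} → EGF d s → EGF e t → EGF (d ℕ.* e) (s ∗ t)
EGF-∗ p q .coeff-∣ j = go j p q
  where
  go : ∀ {d e s t} j → EGF d s → EGF e t → d ℕ.* e ∣ℚ ν (j !) * (s ∗ t) j
  go {d} {e} {s} {t} zero p q = subst (d ℕ.* e ∣ℚ_)
    (solve 2 (λ a b → (con 1ℚ ⊠ a) ⊠ (con 1ℚ ⊠ b) := con 1ℚ ⊠ (a ⊠ b)) refl (s 0) (t 0))
    (∣ℚ-* (p .coeff-∣ 0) (q .coeff-∣ 0))
  go {d} {e} {s} {t} (suc j) p q = subst (d ℕ.* e ∣ℚ_)
    (trans (sym (ℚ.*-distribˡ-+ (ν (j !)) ((D s ∗ t) j) ((s ∗ D t) j)))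
      (trans (cong (ν (j !) *_) (sym (D-∗ s t j))) (!-D (s ∗ t) j)))
    (∣ℚ-+ (go j (EGF-D p) q) (go j p (EGF-D q)))

EGF-if : ∀ {d s} b → EGF d s → EGF d (λ j → if b then s j else 0ℚ)
EGF-if true  p = p
EGF-if false p = EGF-zero

EGF-sumTo : ∀ {d} n {F : ℕ → ℕ → ℚ} → (∀ r → EGF d (F r)) → EGF d (λ j → sumTo n (λ r → F r j))
EGF-sumTo zero    p = EGF-zero
EGF-sumTo (suc n) p = EGF-+ (EGF-sumTo n p) (p n)

EGFs : ℕ → Ser → Set
EGFs d f = ∀ n → EGF d (f n)

EGFs-∗ : ∀ {d e f g} → EGFs d f → EGFs e g → EGFs (d ℕ.* e) (f Ser₂.∗ g)
EGFs-∗ p q zero    = EGF-∗ (p 0) (q 0)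
EGFs-∗ p q (suc n) = EGF-+ (EGF-∗ (p 0) (q (suc n))) (EGFs-∗ (p ∘ suc) q n)

EGFs-⊗ : ∀ {d e f g} → EGFs d f → EGFs e g → EGFs (d ℕ.* e) (f ⊗ g)
EGFs-⊗ {f = f} {g} p q n = EGF-cong (λ j → sym (⊗-∗ f g n j)) (EGFs-∗ p q n)

-- The images of symmetric integral Laurent polynomials in ζ satisfy this.
record EvenRow (s : ℕ → ℚ) : Set where
  field
    integral : EGF 1 s
    even     : EGF 2 (D s)
open EvenRow

EvenRow-cong : ∀ {s t} → (∀ j → s j ≡ t j) → EvenRow s → EvenRow t
EvenRow-cong p g .integral = EGF-cong p (g .integral)
EvenRow-cong p g .even     = EGF-cong (λ j → cong (ν (suc j) *_) (p (suc j))) (g .even)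

EvenRow-const : ∀ {s} → 1 ∣ℚ s 0 → (∀ j → s (suc j) ≡ 0ℚ) → EvenRow s
EvenRow-const {s} p z .integral .coeff-∣ zero    = subst (1 ∣ℚ_) (sym (ℚ.*-identityˡ (s 0))) p
EvenRow-const {s} p z .integral .coeff-∣ (suc j) =
  subst (1 ∣ℚ_) (sym (trans (cong (ν (suc j !) *_) (z j)) (ℚ.*-zeroʳ (ν (suc j !))))) ∣ℚ-zero
EvenRow-const {s} p z .even =
  EGF-cong (λ j → sym (trans (cong (ν (suc j) *_) (z j)) (ℚ.*-zeroʳ (ν (suc j))))) EGF-zero

EvenRow-zero : EvenRow (λ _ → 0ℚ)
EvenRow-zero = EvenRow-const ∣ℚ-zero (λ _ → refl)

EvenRow-+ : ∀ {s t} → EvenRow s → EvenRow t → EvenRow (λ j → s j + t j)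
EvenRow-+         p q .integral = EGF-+ (p .integral) (q .integral)
EvenRow-+ {s} {t} p q .even     = EGF-cong (λ j → sym (ℚ.*-distribˡ-+ (ν (suc j)) (s (suc j)) (t (suc j))))
  (EGF-+ (p .even) (q .even))

EvenRow-neg : ∀ {s} → EvenRow s → EvenRow (λ j → - s j)
EvenRow-neg     p .integral = EGF-neg (p .integral)
EvenRow-neg {s} p .even     = EGF-cong (λ j → ℚ.neg-distribʳ-* (ν (suc j)) (s (suc j))) (EGF-neg (p .even))

-- By the Leibniz rule, each summand of the derivative has one even and one integral factor.
EvenRow-∗ : ∀ {s t} → EvenRow s → EvenRow t → EvenRow (s ∗ t)
EvenRow-∗         p q .integral = EGF-∗ (p .integral) (q .integral)
EvenRow-∗ {s} {t} p q .even     = EGF-cong (λ j → sym (D-∗ s t j))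
  (EGF-+ (EGF-∗ (p .even) (q .integral)) (EGF-∗ (p .integral) (q .even)))

Even : Ser → Set
Even f = ∀ n → EvenRow (f n)

Even-∗ : ∀ {f g} → Even f → Even g → Even (f Ser₂.∗ g)
Even-∗ p q zero    = EvenRow-∗ (p 0) (q 0)
Even-∗ p q (suc n) = EvenRow-+ (EvenRow-∗ (p 0) (q (suc n))) (Even-∗ (p ∘ suc) q n)

Even-⊗ : ∀ {f g} → Even f → Even g → Even (f ⊗ g)
Even-⊗ {f} {g} p q n = EvenRow-cong (λ j → sym (⊗-∗ f g n j)) (Even-∗ p q n)

Even-⊕ : ∀ {f g} → Even f → Even g → Even (f ⊕ g)
Even-⊕ p q n = EvenRow-+ (p n) (q n)

Even-⊖ : ∀ {f g} → Even f → Even g → Even (f ⊖ g)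
Even-⊖ p q n = EvenRow-+ (p n) (EvenRow-neg (q n))

Even-oneS : Even oneS
Even-oneS zero    = EvenRow-const (1∣ℚ-ι (+ 1)) (λ _ → refl)
Even-oneS (suc n) = EvenRow-zero

Even-qpow : ∀ e → Even (qpow e)
Even-qpow e n with e ≤ᵇ n
... | true  = Even-oneS (n ∸ e)
... | false = EvenRow-zero

Even-prodTo : ∀ n {F} → (∀ i → Even (F i)) → Even (prodTo n F)
Even-prodTo zero    p = Even-oneS
Even-prodTo (suc n) p = Even-⊗ (Even-prodTo n p) (p n)

Even-qPochInf : Even qPochInf
-- The length of the finite product varies with `n`, which is harmless since evenness is a condition
-- on single rows.
Even-qPochInf n = Even-prodTo n (λ i → Even-⊖ Even-oneS (Even-qpow (suc i))) n

Even-theta : ∀ a b → Even (theta a b)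
Even-theta a b n = EvenRow-const (∣ℚ-sumTo (suc (2 ℕ.* n)) term) (λ _ → refl)
  where
  term : ∀ i → let t = + i ℤ.- + n in
    1 ∣ℚ (if does ((+ 2) ℤ.* (+ n) ℤ.≟ (+ b) ℤ.* t ℤ.* t ℤ.+ (+ a) ℤ.* t) then ((-[1+ 0 ] ℤ.^ ℤ.∣ t ∣) / 1) else 0ℚ)
  term i with does ((+ 2) ℤ.* (+ n) ℤ.≟ (+ b) ℤ.* (+ i ℤ.- + n) ℤ.* (+ i ℤ.- + n) ℤ.+ (+ a) ℤ.* (+ i ℤ.- + n))
  ... | true  = 1∣ℚ-ι (-[1+ 0 ] ℤ.^ ℤ.∣ + i ℤ.- + n ∣)
  ... | false = ∣ℚ-zero

-- Geometric series and Pochhammer symbols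

!-expZ : ∀ a j → ν (j !) * expZ a j ≡ ι (a ℤ.^ j)
!-expZ a j = trans (ℚ.*-comm (ν (j !)) (expZ a j)) (/-cancel (a ℤ.^ j) (j !))
  where instance _ = j ℕ.!≢0

EGF-expZ : ∀ a → EGF 1 (expZ a)
EGF-expZ a .coeff-∣ j = subst (1 ∣ℚ_) (sym (!-expZ a j)) (1∣ℚ-ι (a ℤ.^ j))

EGFs-geo : ∀ s m → EGFs 1 (geo s m)
EGFs-geo s m n = EGF-sumTo (suc n) (λ r → EGF-if (m ℕ.* r ≡ᵇ n) (EGF-expZ (s ℤ.* + r)))

-- `- a` and `a` agree modulo 2. As j! times the coefficient of x^j in ζ^a is the j-th power of `a`,
-- this is the source of the congruence of ζ^(-a) and ζ^a.
neg-^-parity : ∀ a j → ∃ λ w → (ℤ.- a) ℤ.^ j ℤ.- a ℤ.^ j ≡ + 2 ℤ.* w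
neg-^-parity a zero = + 0 , refl
neg-^-parity a (suc j) with neg-^-parity a j
-- From -ab - ac = -a(b - c) - 2ac with b - c = 2w.
... | w , eq = ℤ.- a ℤ.* w ℤ.- a ℤ.* a ℤ.^ j , (begin
  ℤ.- a ℤ.* b ℤ.- a ℤ.* c
    ≡⟨ ℤ-Solver.solve 3 (λ a b c → (:- a) :* b :- a :* c :≡ (:- a) :* (b :- c) :- ℤ-Solver.con (+ 2) :* (a :* c)) refl a b c ⟩
  ℤ.- a ℤ.* (b ℤ.- c) ℤ.- + 2 ℤ.* (a ℤ.* c)
    ≡⟨ cong (λ z → ℤ.- a ℤ.* z ℤ.- + 2 ℤ.* (a ℤ.* c)) eq ⟩
  ℤ.- a ℤ.* (+ 2 ℤ.* w) ℤ.- + 2 ℤ.* (a ℤ.* c)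
    ≡⟨ ℤ-Solver.solve 3 (λ a w c → (:- a) :* (ℤ-Solver.con (+ 2) :* w) :- ℤ-Solver.con (+ 2) :* (a :* c) :≡
         ℤ-Solver.con (+ 2) :* ((:- a) :* w :- a :* c)) refl a w c ⟩
  + 2 ℤ.* (ℤ.- a ℤ.* w ℤ.- a ℤ.* c) ∎)
  where
  open ≡-Reasoning
  open ℤ-Solver using (_:*_; _:-_; :-_) renaming (_:=_ to _:≡_)
  b = (ℤ.- a) ℤ.^ j
  c = a ℤ.^ j

EGF-expZ-neg : ∀ a → EGF 2 (λ j → expZ (ℤ.- a) j - expZ a j)
EGF-expZ-neg a .coeff-∣ j with neg-^-parity a j
... | w , eq = divides w (begin
  ν (j !) * (expZ (ℤ.- a) j - expZ a j)
    ≡⟨ solve 3 (λ f x y → f ⊠ (x ⊟′ y) := f ⊠ x ⊟′ f ⊠ y) refl (ν (j !)) (expZ (ℤ.- a) j) (expZ a j) ⟩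
  ν (j !) * expZ (ℤ.- a) j - ν (j !) * expZ a j ≡⟨ cong₂ _-_ (!-expZ (ℤ.- a) j) (!-expZ a j) ⟩
  ι ((ℤ.- a) ℤ.^ j) - ι (a ℤ.^ j)               ≡⟨ cong (_+_ (ι ((ℤ.- a) ℤ.^ j))) (ι-neg (a ℤ.^ j)) ⟨
  ι ((ℤ.- a) ℤ.^ j) + ι (ℤ.- (a ℤ.^ j))         ≡⟨ ι-+ ((ℤ.- a) ℤ.^ j) (ℤ.- (a ℤ.^ j)) ⟨
  ι ((ℤ.- a) ℤ.^ j ℤ.- a ℤ.^ j)                 ≡⟨ cong ι eq ⟩
  ι (+ 2 ℤ.* w)                                 ≡⟨ ι-* (+ 2) w ⟩
  ν 2 * ι w ∎)
  where open ≡-Reasoning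

infix 4 _≡₂_
-- Congruence modulo 2 in the ring of integral series. The difference is kept as a series, because
-- `Even-⊗-≡₂` has to differentiate it.
record _≡₂_ (f g : Ser) : Set where
  constructor mk≡₂
  field
    diff      : Ser
    diff-even : EGFs 2 diff
    split     : ∀ n j → g n j ≡ f n j + diff n j

sumTo-- : ∀ n f g → sumTo n (λ i → f i - g i) ≡ sumTo n f - sumTo n g
sumTo-- zero    f g = refl
sumTo-- (suc n) f g = trans (cong (_+ (f n - g n)) (sumTo-- n f g))
  (solve 4 (λ a b c d → (a ⊟′ b) ⊞ (c ⊟′ d) := (a ⊞ c) ⊟′ (b ⊞ d)) refl (sumTo n f) (sumTo n g) (f n) (g n))

-- Termwise comparison of ζ^r and ζ^(-r).
≡₂-geo : ∀ m → geo (+ 1) m ≡₂ geo -[1+ 0 ] m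
≡₂-geo m = mk≡₂ (geo -[1+ 0 ] m ⊖ geo (+ 1) m)
  (λ n → EGF-cong (λ j → sumTo-- (suc n) (term -[1+ 0 ] n j) (term (+ 1) n j)) (EGF-sumTo (suc n) (term-even n)))
  (λ n j → solve 2 (λ a b → b := a ⊞ (b ⊟′ a)) refl (geo (+ 1) m n j) (geo -[1+ 0 ] m n j))
  where
  term : ℤ → ℕ → ℕ → ℕ → ℚ
  term s n j r = if m ℕ.* r ≡ᵇ n then expZ (s ℤ.* + r) j else 0ℚ
  term-even : ∀ n r → EGF 2 (λ j → term -[1+ 0 ] n j r - term (+ 1) n j r)
  term-even n r with m ℕ.* r ≡ᵇ n
  ... | false = EGF-zero
  ... | true  = EGF-cong (λ j → cong₂ (λ a b → expZ a j - expZ b j) (sym (ℤ.-1*i≡-i (+ r))) (sym (ℤ.*-identityˡ (+ r))))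
                  (EGF-expZ-neg (+ r))

≡₂-⊗ : ∀ {f f′ g g′} → EGFs 1 f → EGFs 1 f′ → f ≡₂ g → f′ ≡₂ g′ → f ⊗ f′ ≡₂ g ⊗ g′
≡₂-⊗ {f} {f′} {g} {g′} hf hf′ (mk≡₂ e p eq) (mk≡₂ e′ p′ eq′) = mk≡₂
  (((f Ser₂.∗ e′) ⊕ (e Ser₂.∗ f′)) ⊕ (e Ser₂.∗ e′))
  -- In the last product one factor is weakened to an integral one, so that the product counts as
  -- divisible by 2 instead of 4.
  (λ n → EGF-+ (EGF-+ (EGFs-∗ hf p′ n) (EGFs-∗ p hf′ n)) (EGFs-∗ p (λ i → EGF-2⇒1 (p′ i)) n))
  (λ n j → begin
    (g ⊗ g′) n j                   ≡⟨ ⊗-cong {g} {f ⊕ e} {g′} {f′ ⊕ e′} eq eq′ n j ⟩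
    ((f ⊕ e) ⊗ (f′ ⊕ e′)) n j      ≡⟨ ⊗-∗ (f ⊕ e) (f′ ⊕ e′) n j ⟩
    ((f ⊕ e) Ser₂.∗ (f′ ⊕ e′)) n j ≡⟨ ∂-Properties.*-expand f e f′ e′ n j ⟩
    (f Ser₂.∗ f′) n j + (((f Ser₂.∗ e′) n j + (e Ser₂.∗ f′) n j) + (e Ser₂.∗ e′) n j)
      ≡⟨ cong (_+ (((f Ser₂.∗ e′) n j + (e Ser₂.∗ f′) n j) + (e Ser₂.∗ e′) n j)) (⊗-∗ f f′ n j) ⟨
    (f ⊗ f′) n j + (((f Ser₂.∗ e′) n j + (e Ser₂.∗ f′) n j) + (e Ser₂.∗ e′) n j) ∎)
  where open ≡-Reasoning

EGFs-prodTo : ∀ n {F} → (∀ i → EGFs 1 (F i)) → EGFs 1 (prodTo n F)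
EGFs-prodTo zero    p n = Even-oneS n .integral
EGFs-prodTo (suc n) p   = EGFs-⊗ (EGFs-prodTo n p) (p n)

≡₂-prodTo : ∀ n {F G} → (∀ i → EGFs 1 (F i)) → (∀ i → F i ≡₂ G i) → prodTo n F ≡₂ prodTo n G
≡₂-prodTo zero    p c = mk≡₂ (λ _ _ → 0ℚ) (λ _ → EGF-zero) (λ n j → sym (ℚ.+-identityʳ (oneS n j)))
≡₂-prodTo (suc n) p c = ≡₂-⊗ (EGFs-prodTo n p) (p n) (≡₂-prodTo n p c) (c n)

-- If g = f + e with e even, then ∂ (f g) = 2 f ∂f + (∂f e + f ∂e) is even.
Even-⊗-≡₂ : ∀ {f g} → EGFs 1 f → f ≡₂ g → Even (f ⊗ g)
Even-⊗-≡₂ {f} {g} hf (mk≡₂ e p eq) n =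
  EvenRow-cong (λ j → sym (trans (⊗-cong {f} {f} {g} (λ _ _ → refl) eq n j) (⊗-∗ f (f ⊕ e) n j))) record
    { integral = EGFs-∗ hf (λ i → EGF-+ (hf i) (EGF-2⇒1 (p i))) n
    ; even     = EGF-cong (λ j → sym (∂-Properties.δ-near-square f e n j))
        (EGF-+ (EGF-double (EGFs-∗ hf h∂f n))
               (EGF-+ (EGFs-∗ h∂f p n) (EGFs-∗ hf (λ i → EGF-D (p i)) n))) }
  where
  h∂f : EGFs 1 (∂ f)
  h∂f i = EGF-D (hf i)

-- The series is 1/(1 - q^m), free of x: the higher coefficients contain positive powers of 0.
Even-geo-0 : ∀ m → Even (geo (+ 0) m)
Even-geo-0 m n = EvenRow-const (∣ℚ-sumTo (suc n) constant) (λ j → sumTo-zero (suc n) (higher j))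
  where
  constant : ∀ r → 1 ∣ℚ (if m ℕ.* r ≡ᵇ n then expZ (+ 0) 0 else 0ℚ)
  constant r with m ℕ.* r ≡ᵇ n
  ... | true  = 1∣ℚ-ι (+ 1)
  ... | false = ∣ℚ-zero
  higher : ∀ j r → (if m ℕ.* r ≡ᵇ n then expZ (+ 0) (suc j) else 0ℚ) ≡ 0ℚ
  higher j r with m ℕ.* r ≡ᵇ n
  ... | true  = ℚ.0/n≡0 (suc j !)
    where instance _ = suc j ℕ.!≢0
  ... | false = refl

Even-pochInv-0 : ∀ n → Even (pochInv (+ 0) n)
Even-pochInv-0 n = Even-prodTo n (λ i → Even-geo-0 (suc i))

-- The two factors are exchanged by ζ ↦ ζ⁻¹, hence congruent modulo 2, and their product is a square
-- up to an even error.
Even-pochInv-± : ∀ n → Even (pochInv (+ 1) n ⊗ pochInv -[1+ 0 ] n)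
Even-pochInv-± n = Even-⊗-≡₂ (EGFs-prodTo n (λ i → EGFs-geo (+ 1) (suc i)))
  (≡₂-prodTo n (λ i → EGFs-geo (+ 1) (suc i)) (λ i → ≡₂-geo (suc i)))

Even-diffs : ∀ l → Even (diffs l)
Even-diffs []          = Even-oneS
Even-diffs (a ∷ [])    = Even-oneS
Even-diffs (a ∷ b ∷ t) = Even-⊗ (Even-pochInv-0 (b ∸ a)) (Even-diffs (b ∷ t))

Even-fgTerm : ∀ l → Even (fgTerm l)
Even-fgTerm []          = Even-oneS
Even-fgTerm (n₁ ∷ rest) = Even-⊗
  -- Only the product of the two ζ-dependent factors is shown to be even, so they have to be
  -- bracketed together.
  (λ n → EvenRow-cong (λ j → sym (⊗-assoc (qpow (sqSum (n₁ ∷ rest))) (pochInv (+ 1) n₁) (pochInv -[1+ 0 ] n₁) n j))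
    (Even-⊗ (Even-qpow (sqSum (n₁ ∷ rest))) (Even-pochInv-± n₁) n))
  (Even-diffs (n₁ ∷ rest))

Even-FG : ∀ k → Even (FG k)
Even-FG k n = go (chains (k ∸ 1) 1 n)
  where
  go : ∀ cs → EvenRow (λ j → sumList (map (λ c → fgTerm c n j) cs))
  go []       = EvenRow-zero
  go (c ∷ cs) = EvenRow-+ (Even-fgTerm c n) (go cs)

Even-Gser : ∀ k → Even (Gser k)
Even-Gser k = Even-⊕ (Even-theta 1 (2 ℕ.* k ∸ 1)) (Even-⊗ Even-qPochInf (Even-FG k))

-- The derivative of the logarithm

open import Algebra.Properties.Semiring.Mult (CommutativeRing.semiring Ser₂.∗-commutativeRing) using (_×_)

sumTo-*ˡ : ∀ n f c → c * sumTo n f ≡ sumTo n (λ i → c * f i)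
sumTo-*ˡ zero    f c = ℚ.*-zeroʳ c
sumTo-*ˡ (suc n) f c = trans (ℚ.*-distribˡ-+ c (sumTo n f) (f n)) (cong (_+ c * f n) (sumTo-*ˡ n f c))

×-coeff : ∀ m f n j → (m × f) n j ≡ ν m * f n j
×-coeff zero    f n j = sym (ℚ.*-zeroˡ (f n j))
×-coeff (suc m) f n j = trans (cong (_+_ (f n j)) (×-coeff m f n j))
  (trans (solve 2 (λ m x → x ⊞ m ⊠ x := (con 1ℚ ⊞ m) ⊠ x) refl (ν m) (f n j)) (cong (_* f n j) (sym (ν-suc m))))

sgn : ℕ → ℚ
sgn m = ι (-[1+ 0 ] ℤ.^ m)

-- Differentiating the power `suc m` of `F` cancels the denominator `suc m` of the logarithm series;
-- only integer coefficients remain.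
D-log1p : ∀ F n j → ν (suc j) * log1p F n (suc j) ≡ sumTo (n ℕ.+ suc j) (λ m → sgn m * (F ^ m Ser₂.∗ ∂ F) n j)
D-log1p F n j = trans (sumTo-*ˡ (n ℕ.+ suc j) _ (ν (suc j))) (sumTo-cong (n ℕ.+ suc j) term)
  where
  open ≡-Reasoning
  term : ∀ m → ν (suc j) * (((-[1+ 0 ] ℤ.^ m) / suc m) * powS F (suc m) n (suc j)) ≡ sgn m * (F ^ m Ser₂.∗ ∂ F) n j
  term m = begin
    ν (suc j) * (c * powS F (suc m) n (suc j))
      ≡⟨ cong (λ z → ν (suc j) * (c * z)) (powS-^ F (suc m) n (suc j)) ⟩
    ν (suc j) * (c * (F ^ suc m) n (suc j))
      ≡⟨ solve 3 (λ a b c → a ⊠ (b ⊠ c) := b ⊠ (a ⊠ c)) refl (ν (suc j)) c ((F ^ suc m) n (suc j)) ⟩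
    c * ∂ (F ^ suc m) n j
      ≡⟨ cong (c *_) (trans (∂-Properties.δ-^ F m n j) (×-coeff (suc m) (F ^ m Ser₂.∗ ∂ F) n j)) ⟩
    c * (ν (suc m) * (F ^ m Ser₂.∗ ∂ F) n j)
      ≡⟨ ℚ.*-assoc c (ν (suc m)) _ ⟨
    c * ν (suc m) * (F ^ m Ser₂.∗ ∂ F) n j
      ≡⟨ cong (_* (F ^ m Ser₂.∗ ∂ F) n j) (/-cancel (-[1+ 0 ] ℤ.^ m) (suc m)) ⟩
    sgn m * (F ^ m Ser₂.∗ ∂ F) n j ∎
    where c = (-[1+ 0 ] ℤ.^ m) / suc m

EGF-scale : ∀ {d s} z → EGF d s → EGF d (λ j → ι z * s j)
EGF-scale {d} {s} z p .coeff-∣ j = subst (d ∣ℚ_)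
  (solve 3 (λ a b c → (a ⊠ b) ⊠ c := a ⊠ (c ⊠ b)) refl (ν (j !)) (s j) (ι z))
  (subst (_∣ℚ (ν (j !) * s j * ι z)) (ℕ.*-identityʳ d) (∣ℚ-* (p .coeff-∣ j) (1∣ℚ-ι z)))

EGFs-^ : ∀ {F} m → EGFs 1 F → EGFs 1 (F ^ m)
EGFs-^ zero    p n = EGF-cong (oneS-1s n) (Even-oneS n .integral)
EGFs-^ (suc m) p   = EGFs-∗ p (EGFs-^ m p)

-- Each summand of `D-log1p` is an integral power of `F` times the even series `∂ F`.
log1p-even : ∀ {F} → Even F → ∀ n j → 2 ∣ℚ ν (suc j !) * log1p F n (suc j)
log1p-even {F} p n j = subst (2 ∣ℚ_)
  (trans (cong (ν (j !) *_) (sym (D-log1p F n j))) (!-D (log1p F n) j))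
  (EGF-sumTo (n ℕ.+ suc j) {λ m j → sgn m * (F ^ m Ser₂.∗ ∂ F) n j}
    (λ m → EGF-scale (-[1+ 0 ] ℤ.^ m) (EGFs-∗ (EGFs-^ m (λ i → p i .integral)) (λ i → p i .even) n)) .coeff-∣ j)

-- Constancy in q

row-zeroʳ : ∀ s t → (∀ j → t j ≡ 0ℚ) → ∀ j → (s ∗ t) j ≡ 0ℚ
row-zeroʳ s t p j = trans (Row.∗-comm s t j) (trans (Row.∗-cong {g = s} {g′ = s} p (λ _ → refl) j) (Row.∗-zeroˡ s j))

QConst : Ser → Set
QConst f = ∀ n j → f (suc n) j ≡ 0ℚ

QConst-∗ : ∀ {f g} → QConst f → QConst g → QConst (f Ser₂.∗ g)
QConst-∗ {f} {g} p q n j = cong₂ _+_ (row-zeroʳ (f 0) (g (suc n)) (q n) j)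
  (trans (Ser₂.∗-cong {f ∘ suc} {λ _ _ → 0ℚ} {g} {g} p (λ _ _ → refl) n j) (Ser₂.∗-zeroˡ g n j))

QConst-^ : ∀ {f} m → QConst f → QConst (f ^ m)
QConst-^ zero    p n j = refl
QConst-^ {f} (suc m) p = QConst-∗ {f} {f ^ m} p (QConst-^ m p)

log1p-QConst : ∀ {F} → QConst F → QConst (log1p F)
log1p-QConst {F} p n j = sumTo-zero (suc n ℕ.+ j) (λ m →
  trans (cong (((-[1+ 0 ] ℤ.^ m) / suc m) *_) (trans (powS-^ F (suc m) (suc n) j) (QConst-^ {F} (suc m) p n j)))
        (ℚ.*-zeroʳ ((-[1+ 0 ] ℤ.^ m) / suc m)))

log1p-row0 : ∀ {F} → (∀ j → F 0 j ≡ 0ℚ) → ∀ j → log1p F 0 j ≡ 0ℚ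
log1p-row0 {F} p j = sumTo-zero j (λ m →
  trans (cong (((-[1+ 0 ] ℤ.^ m) / suc m) *_) (trans (powS-^ F (suc m) 0 j)
          (trans (Row.∗-comm (F 0) ((F ^ m) 0) j) (row-zeroʳ ((F ^ m) 0) (F 0) p j))))
        (ℚ.*-zeroʳ ((-[1+ 0 ] ℤ.^ m) / suc m)))

sinc-1-qconst : QConst (sincSer ⊖ oneS)
sinc-1-qconst n j = refl

theta-row0 : ∀ a b j → theta a b 0 j ≡ oneS 0 j
theta-row0 a b (suc j) = refl
-- For `n = 0` the sum has the single index t = 0, whose exponent is 0 and whose sign is +1.
theta-row0 a b zero    = cong (λ c → 0ℚ + (if c then 1ℚ else 0ℚ)) (dec-true (_ ℤ.≟ _) (sym eq))
  where
  eq : (+ b) ℤ.* + 0 ℤ.* + 0 ℤ.+ (+ a) ℤ.* + 0 ≡ + 0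
  eq = cong₂ ℤ._+_ (ℤ.*-zeroʳ ((+ b) ℤ.* + 0)) (ℤ.*-zeroʳ (+ a))

-- No chain with entries at least 1 is bounded by 0, so FG has no constant term in q and theta alone
-- supplies the 1. Writing the index as `suc (suc k)` makes the chains visibly nonempty, and the
-- list of chains computes to `[]`.
Gser-1-row0 : ∀ k j → (Gser (suc (suc k)) ⊖ oneS) 0 j ≡ 0ℚ
Gser-1-row0 k j = begin
  theta 1 b 0 j + (qPochInf ⊗ FG (suc (suc k))) 0 j - oneS 0 j
    ≡⟨ cong₂ (λ x y → x + y - oneS 0 j) (theta-row0 1 b j)
         (trans (⊗-∗ qPochInf (FG (suc (suc k))) 0 j) (row-zeroʳ (qPochInf 0) (FG (suc (suc k)) 0) (λ _ → refl) j)) ⟩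
  oneS 0 j + 0ℚ - oneS 0 j
    ≡⟨ solve 1 (λ x → x ⊞ con 0ℚ ⊟′ x := con 0ℚ) refl (oneS 0 j) ⟩
  0ℚ ∎
  where
  open ≡-Reasoning
  b = 2 ℕ.* suc (suc k) ∸ 1

-- The series u = (e^x - 1)/x and its logarithmic derivative

exp : ℚ → ℕ → ℚ
exp a j = powQ a j * j !⁻¹

D-exp : ∀ a j → D (exp a) j ≡ a * exp a j
D-exp a j = trans
  (solve 4 (λ n a p r → n ⊠ (a ⊠ p ⊠ r) := a ⊠ (p ⊠ (n ⊠ r))) refl (ν (suc j)) a (powQ a j) (suc j !⁻¹))
  (cong (λ z → a * (powQ a j * z)) (!⁻¹-suc j))

-- The equation y′ = c y is a recursion for the coefficients.
ode-unique : ∀ c s t → s 0 ≡ t 0 → (∀ j → D s j ≡ c * s j) → (∀ j → D t j ≡ c * t j) → ∀ j → s j ≡ t j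
ode-unique c s t e p q zero    = e
ode-unique c s t e p q (suc j) = ν-cancelʳ (suc j) (begin
  s (suc j) * ν (suc j) ≡⟨ ℚ.*-comm (s (suc j)) (ν (suc j)) ⟩
  D s j                 ≡⟨ p j ⟩
  c * s j               ≡⟨ cong (c *_) (ode-unique c s t e p q j) ⟩
  c * t j               ≡⟨ q j ⟨
  D t j                 ≡⟨ ℚ.*-comm (ν (suc j)) (t (suc j)) ⟩
  t (suc j) * ν (suc j) ∎)
  where open ≡-Reasoning

-- Both sides solve y′ = (a + b) y with y(0) = 1.
exp-∗ : ∀ a b j → (exp a ∗ exp b) j ≡ exp (a + b) j
exp-∗ a b = ode-unique (a + b) (exp a ∗ exp b) (exp (a + b)) refl
  (λ j → begin
    D (exp a ∗ exp b) j                           ≡⟨ D-∗ (exp a) (exp b) j ⟩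
    (D (exp a) ∗ exp b) j + (exp a ∗ D (exp b)) j
      ≡⟨ cong₂ _+_ (left a b j) (trans (Row.∗-comm (exp a) (D (exp b)) j) (left b a j)) ⟩
    a * (exp a ∗ exp b) j + b * (exp b ∗ exp a) j
      ≡⟨ cong (λ z → a * (exp a ∗ exp b) j + b * z) (Row.∗-comm (exp b) (exp a) j) ⟩
    a * (exp a ∗ exp b) j + b * (exp a ∗ exp b) j ≡⟨ ℚ.*-distribʳ-+ ((exp a ∗ exp b) j) a b ⟨
    (a + b) * (exp a ∗ exp b) j ∎)
  (D-exp (a + b))
  where
  open ≡-Reasoning
  left : ∀ a b j → (D (exp a) ∗ exp b) j ≡ a * (exp a ∗ exp b) j
  left a b j = trans (Row.∗-cong {g = exp b} {g′ = exp b} (D-exp a) (λ _ → refl) j) (Row.∗-scaleˡ a (exp a) (exp b) j)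

u : ℕ → ℚ
u j = suc j !⁻¹

sinc : ℕ → ℚ
sinc = sincSer 0

powQ-1 : ∀ j → powQ 1ℚ j ≡ 1ℚ
powQ-1 zero    = refl
powQ-1 (suc j) = trans (ℚ.*-identityˡ (powQ 1ℚ j)) (powQ-1 j)

exp-∗-sinc : ∀ j → (exp ½ ∗ sinc) j ≡ u j
exp-∗-sinc j = begin
  (E ∗ sinc) j                    ≡⟨ Row.∗-cong {E} {E} {sinc} {tail H} (λ _ → refl) tail-H j ⟩
  -- The added 0 is `H 0`, which completes the right-hand recursion of the product.
  (E ∗ tail H) j                  ≡⟨ solve 2 (λ x y → x := x ⊞ y ⊠ con 0ℚ) refl _ (E (suc j)) ⟩
  (E ∗ tail H) j + E (suc j) * 0ℚ ≡⟨ Row.∗-sucʳ E H j ⟨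
  (E ∗ H) (suc j)                 ≡⟨ Row.∗-distribˡ E E (λ i → - E⁻ i) (suc j) ⟩
  (E ∗ E) (suc j) + (E ∗ (λ i → - E⁻ i)) (suc j)
    ≡⟨ cong₂ _+_ (exp-∗ ½ ½ (suc j)) (trans (Row.∗-comm E (λ i → - E⁻ i) (suc j))
         (trans (Row.∗-cong {λ i → - E⁻ i} {λ i → (- 1ℚ) * E⁻ i} {E} {E} (λ i → solve 1 (λ x → ⊟ x := (con (- 1ℚ)) ⊠ x) refl (E⁻ i)) (λ _ → refl) (suc j))
         (trans (Row.∗-scaleˡ (- 1ℚ) E⁻ E (suc j)) (cong ((- 1ℚ) *_) (exp-∗ (- ½) ½ (suc j)))))) ⟩
  -- ½ + ½ and -½ + ½ have been evaluated; the positive power of 0 removes the second term.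
  powQ 1ℚ (suc j) * suc j !⁻¹ + (- 1ℚ) * (0ℚ * powQ 0ℚ j * suc j !⁻¹)
    ≡⟨ cong (λ z → z * suc j !⁻¹ + (- 1ℚ) * (0ℚ * powQ 0ℚ j * suc j !⁻¹)) (powQ-1 (suc j)) ⟩
  1ℚ * suc j !⁻¹ + (- 1ℚ) * (0ℚ * powQ 0ℚ j * suc j !⁻¹)
    ≡⟨ solve 2 (λ r p → con 1ℚ ⊠ r ⊞ con (- 1ℚ) ⊠ (con 0ℚ ⊠ p ⊠ r) := r) refl (suc j !⁻¹) (powQ 0ℚ j) ⟩
  u j ∎
  where
  open ≡-Reasoning
  E = exp ½
  E⁻ = exp (- ½)
  H : ℕ → ℚ
  H i = E i - E⁻ i
  tail-H : ∀ i → sinc i ≡ tail H i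
  tail-H i = solve 3 (λ a b c → (a ⊟′ b) ⊠ c := a ⊠ c ⊟′ b ⊠ c) refl (powQ ½ (suc i)) (powQ (- ½) (suc i)) (suc i !⁻¹)

-- The constant coefficients agree since `c 0` is 1; their contributions then cancel, and the tails
-- satisfy the same hypothesis.
∗-cancelʳ : ∀ a b c → c 0 ≡ 1ℚ → (∀ j → (a ∗ c) j ≡ (b ∗ c) j) → ∀ j → a j ≡ b j
∗-cancelʳ a b c c₀ p zero = trans (sym (·c₀ (a 0))) (trans (p 0) (·c₀ (b 0)))
  where
  ·c₀ : ∀ x → x * c 0 ≡ x
  ·c₀ x = trans (cong (x *_) c₀) (ℚ.*-identityʳ x)
∗-cancelʳ a b c c₀ p (suc j) = ∗-cancelʳ (tail a) (tail b) c c₀ (λ i → +-cancelˡ (a 0 * c (suc i)) ((tail a ∗ c) i) ((tail b ∗ c) i)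
    (trans (p (suc i)) (cong (λ z → z * c (suc i) + (tail b ∗ c) i) (sym (∗-cancelʳ a b c c₀ p 0))))) j

-- The logarithmic derivative of sinc

sinc-1 : Ser
sinc-1 = sincSer ⊖ oneS

-- Up to sign, the summands of `D-log1p` for sinc - 1, in degree 0 of q.
powerTerm : ℕ → ℕ → ℚ
powerTerm m = (sinc-1 ^ m Ser₂.∗ ∂ sinc-1) 0

powerTerm-zero : ∀ j → powerTerm 0 j ≡ D sinc j
powerTerm-zero j = trans (Row.∗-identityˡ (∂ sinc-1 0) j) (cong (ν (suc j) *_) (ℚ.+-identityʳ (sinc (suc j))))

powerTerm-suc : ∀ m j → powerTerm (suc m) j ≡ (sinc-1 0 ∗ powerTerm m) j
powerTerm-suc m j = Row.∗-assoc (sinc-1 0) ((sinc-1 ^ m) 0) (∂ sinc-1 0) j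

-- The constant coefficient of sinc - 1 evaluates to 0, so each further factor raises the order in
-- x.
powerTerm-vanish : ∀ m {j} → j ℕ.< m → powerTerm m j ≡ 0ℚ
powerTerm-vanish (suc m) {j} j<m = trans (powerTerm-suc m j) (go j j<m)
  where
  go : ∀ j → j ℕ.< suc m → (sinc-1 0 ∗ powerTerm m) j ≡ 0ℚ
  go zero    _ = ℚ.*-zeroˡ (powerTerm m 0)
  go (suc j) (s≤s j<m) = trans (cong₂ _+_ (ℚ.*-zeroˡ (powerTerm m (suc j)))
    (trans (Row.∗-cong-≤ {tail (sinc-1 0)} {tail (sinc-1 0)} {powerTerm m} {λ _ → 0ℚ} j
             (λ _ _ → refl) (λ i i≤j → powerTerm-vanish m (ℕ.≤-<-trans i≤j j<m)))
           (row-zeroʳ (tail (sinc-1 0)) (λ _ → 0ℚ) (λ _ → refl) j))) (ℚ.+-identityʳ 0ℚ)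

partialSum : ℕ → ℕ → ℚ
partialSum N j = sumTo N (λ m → sgn m * powerTerm m j)

-- The bound `suc j` is the one in `D-log1p` for `n = 0`. It cuts off only zeros, by
-- `powerTerm-vanish`, so this diagonal is the full infinite sum.
dlog-sinc : ℕ → ℚ
dlog-sinc j = partialSum (suc j) j

sgn-suc : ∀ m → sgn (suc m) ≡ - sgn m
sgn-suc m = trans (cong ι (ℤ.-1*i≡-i (-[1+ 0 ] ℤ.^ m))) (ι-neg (-[1+ 0 ] ℤ.^ m))

partialSum-stable : ∀ d j → partialSum (d ℕ.+ suc j) j ≡ dlog-sinc j
partialSum-stable zero    j = refl
partialSum-stable (suc d) j = trans
  (cong₂ _+_ (partialSum-stable d j) (trans (cong (sgn m *_) (powerTerm-vanish m (ℕ.m≤n+m (suc j) d))) (ℚ.*-zeroʳ (sgn m))))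
  (ℚ.+-identityʳ (dlog-sinc j))
  where m = d ℕ.+ suc j

∗-partialSum : ∀ s N j → (s ∗ partialSum N) j ≡ sumTo N (λ m → sgn m * (s ∗ powerTerm m) j)
∗-partialSum s zero    j = row-zeroʳ s (λ _ → 0ℚ) (λ _ → refl) j
∗-partialSum s (suc N) j = trans (Row.∗-distribˡ s (partialSum N) (λ i → sgn N * powerTerm N i) j)
  (cong₂ _+_ (∗-partialSum s N j) (trans (Row.∗-comm s (λ i → sgn N * powerTerm N i) j)
    (trans (Row.∗-scaleˡ (sgn N) (powerTerm N) s j) (cong (sgn N *_) (Row.∗-comm (powerTerm N) s j)))))

-- The geometric series: for F = sinc - 1, multiplying Σ (-F)^m F′ by 1 + F telescopes to F′.
sinc-1∗dlog-sinc : ∀ j → (sinc-1 0 ∗ dlog-sinc) j + dlog-sinc j ≡ D sinc j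
sinc-1∗dlog-sinc j = begin
  (sinc-1 0 ∗ dlog-sinc) j + dlog-sinc j
    ≡⟨ cong (_+ dlog-sinc j) (Row.∗-cong-≤ {sinc-1 0} {sinc-1 0} {dlog-sinc} {partialSum (suc j)} j (λ _ _ → refl) stable) ⟩
  (sinc-1 0 ∗ partialSum (suc j)) j + dlog-sinc j ≡⟨ cong (_+ dlog-sinc j) (∗-partialSum (sinc-1 0) (suc j) j) ⟩
  -- The second sum is prolonged by one vanishing term, so that without its term `m = 0` it cancels
  -- the first sum term by term.
  sumTo (suc j) a + dlog-sinc j                   ≡⟨ cong (_+_ (sumTo (suc j) a)) (partialSum-stable 1 j) ⟨
  sumTo (suc j) a + partialSum (2 ℕ.+ j) j        ≡⟨ cong (_+_ (sumTo (suc j) a)) (sumTo-head (suc j) _) ⟩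
  sumTo (suc j) a + (1ℚ * powerTerm 0 j + sumTo (suc j) b)
    ≡⟨ solve 3 (λ a y b → a ⊞ (con 1ℚ ⊠ y ⊞ b) := y ⊞ (a ⊞ b)) refl (sumTo (suc j) a) (powerTerm 0 j) (sumTo (suc j) b) ⟩
  powerTerm 0 j + (sumTo (suc j) a + sumTo (suc j) b)
    ≡⟨ cong (_+_ (powerTerm 0 j)) (trans (sym (sumTo-+ (suc j) a b)) (sumTo-zero (suc j) cancel)) ⟩
  powerTerm 0 j + 0ℚ                              ≡⟨ trans (ℚ.+-identityʳ (powerTerm 0 j)) (powerTerm-zero j) ⟩
  D sinc j ∎
  where
  open ≡-Reasoning
  a b : ℕ → ℚ
  a m = sgn m * (sinc-1 0 ∗ powerTerm m) j
  b m = sgn (suc m) * powerTerm (suc m) j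
  stable : ∀ i → i ℕ.≤ j → dlog-sinc i ≡ partialSum (suc j) i
  stable i i≤j = trans (sym (partialSum-stable (j ∸ i) i))
    (cong (λ N → partialSum N i) (trans (ℕ.+-suc (j ∸ i) i) (cong suc (ℕ.m∸n+n≡m i≤j))))
  cancel : ∀ m → a m + b m ≡ 0ℚ
  cancel m = trans (cong (_+_ (a m)) (cong₂ _*_ (sgn-suc m) (powerTerm-suc m j)))
    (solve 2 (λ c y → c ⊠ y ⊞ (⊟ c) ⊠ y := con 0ℚ) refl (sgn m) ((sinc-1 0 ∗ powerTerm m) j))

sinc∗dlog-sinc : ∀ j → (sinc ∗ dlog-sinc) j ≡ D sinc j
sinc∗dlog-sinc j = begin
  (sinc ∗ dlog-sinc) j
    ≡⟨ Row.∗-cong {sinc} {λ i → sinc-1 0 i + 1s i} {dlog-sinc} {dlog-sinc} split (λ _ → refl) j ⟩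
  ((λ i → sinc-1 0 i + 1s i) ∗ dlog-sinc) j     ≡⟨ Row.∗-distribʳ dlog-sinc (sinc-1 0) 1s j ⟩
  (sinc-1 0 ∗ dlog-sinc) j + (1s ∗ dlog-sinc) j ≡⟨ cong (_+_ ((sinc-1 0 ∗ dlog-sinc) j)) (Row.∗-identityˡ dlog-sinc j) ⟩
  (sinc-1 0 ∗ dlog-sinc) j + dlog-sinc j        ≡⟨ sinc-1∗dlog-sinc j ⟩
  D sinc j ∎
  where
  open ≡-Reasoning
  split : ∀ i → sinc i ≡ sinc-1 0 i + 1s i
  split i = trans (solve 2 (λ s o → s := (s ⊟′ o) ⊞ o) refl (sinc i) (oneS 0 i)) (cong (_+_ (sinc-1 0 i)) (oneS-1s 0 i))

-- sinc = e^{-x/2} u, so sinc′/sinc = u′/u - 1/2.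
dlog-sinc∗u : ∀ j → (dlog-sinc ∗ u) j + ½ * u j ≡ D u j
dlog-sinc∗u j = begin
  (dlog-sinc ∗ u) j + ½ * u j          ≡⟨ cong (_+ ½ * u j) (Row.∗-comm dlog-sinc u j) ⟩
  (u ∗ dlog-sinc) j + ½ * u j          ≡⟨ cong (_+ ½ * u j) (Row.∗-cong {g = dlog-sinc} {g′ = dlog-sinc} exp-∗-sinc (λ _ → refl) j) ⟨
  ((E ∗ sinc) ∗ dlog-sinc) j + ½ * u j ≡⟨ cong (_+ ½ * u j) (Row.∗-assoc E sinc dlog-sinc j) ⟩
  (E ∗ (sinc ∗ dlog-sinc)) j + ½ * u j
    ≡⟨ cong₂ (λ x y → x + ½ * y) (Row.∗-cong {E} {E} (λ _ → refl) sinc∗dlog-sinc j) (sym (exp-∗-sinc j)) ⟩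
  (E ∗ D sinc) j + ½ * (E ∗ sinc) j    ≡⟨ cong (_+_ ((E ∗ D sinc) j)) (Row.∗-scaleˡ ½ E sinc j) ⟨
  (E ∗ D sinc) j + ((λ i → ½ * E i) ∗ sinc) j
    ≡⟨ cong (_+_ ((E ∗ D sinc) j)) (Row.∗-cong {g = sinc} {g′ = sinc} (D-exp ½) (λ _ → refl) j) ⟨
  (E ∗ D sinc) j + (D E ∗ sinc) j      ≡⟨ ℚ.+-comm ((E ∗ D sinc) j) ((D E ∗ sinc) j) ⟩
  (D E ∗ sinc) j + (E ∗ D sinc) j      ≡⟨ D-∗ E sinc j ⟨
  D (E ∗ sinc) j                       ≡⟨ cong (ν (suc j) *_) (exp-∗-sinc (suc j)) ⟩
  D u j ∎
  where
  open ≡-Reasoning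
  E = exp ½

-- Bernoulli numbers

≤⇒≤ᵇ≡true : ∀ {i m} → i ℕ.≤ m → (i ≤ᵇ m) ≡ true
≤⇒≤ᵇ≡true {i} {m} i≤m with i ≤ᵇ m | ℕ.≤⇒≤ᵇ i≤m
... | true | _ = refl

bernUpTo-step : ∀ {m i} → i ℕ.≤ m → bernUpTo (suc m) i ≡ bernUpTo m i
bernUpTo-step {m} {i} i≤m = cong (λ b → if b then bernUpTo m i else - (((+ 1) / suc (suc m)) * X)) (≤⇒≤ᵇ≡true i≤m)
  where X = sumTo (suc m) (λ l → ((+ (suc (suc m) C l)) / 1) * bernUpTo m l)

-- `bernUpTo m` is a table filled up to `m`, and each later stage copies the entries already filled.
bernUpTo-stable : ∀ {m l} → l ℕ.≤′ m → bernUpTo m l ≡ bernoulli l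
bernUpTo-stable ℕ.≤′-refl       = refl
bernUpTo-stable (ℕ.≤′-step l≤m) = trans (bernUpTo-step (ℕ.≤′⇒≤ l≤m)) (bernUpTo-stable l≤m)

sumTo-cong-< : ∀ n {f g} → (∀ i → i ℕ.< n → f i ≡ g i) → sumTo n f ≡ sumTo n g
sumTo-cong-< zero    p = refl
sumTo-cong-< (suc n) p = cong₂ _+_ (sumTo-cong-< n (λ i i<n → p i (ℕ.m≤n⇒m≤1+n i<n))) (p n ℕ.≤-refl)

1+m≤ᵇm≡false : ∀ m → (suc m ≤ᵇ m) ≡ false
1+m≤ᵇm≡false m with suc m ≤ᵇ m in eq
... | false = refl
... | true with () ← ℕ.1+n≰n (ℕ.≤ᵇ⇒≤ (suc m) m (subst T (sym eq) _))

bernoulli-suc : ∀ m → bernoulli (suc m) ≡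
  - (((+ 1) / suc (suc m)) * sumTo (suc m) (λ l → ν (suc (suc m) C l) * bernUpTo m l))
bernoulli-suc m = cong (λ b → if b then bernUpTo m (suc m) else - (((+ 1) / suc (suc m)) * X)) (1+m≤ᵇm≡false m)
  where X = sumTo (suc m) (λ l → ν (suc (suc m) C l) * bernUpTo m l)

[1+n]Cn≡1+n : ∀ n → suc n C n ≡ suc n
[1+n]Cn≡1+n n = trans (nCk≡nC[n∸k] (ℕ.n≤1+n n)) (trans (cong (suc n C_) (ℕ.m+n∸n≡m 1 n)) (nC1≡n (suc n)))

-- The last binomial coefficient is `suc (suc m)`, by which the definition of `bernoulli (suc m)`
-- divides.
bernoulli-recurrence : ∀ m → sumTo (suc (suc m)) (λ l → ν (suc (suc m) C l) * bernoulli l) ≡ 0ℚ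
bernoulli-recurrence m = begin
  sumTo (suc m) (λ l → ν (n C l) * bernoulli l) + ν (n C suc m) * bernoulli (suc m)
    ≡⟨ cong₂ (λ x y → x + ν y * bernoulli (suc m))
         (sumTo-cong-< (suc m) (λ { l (s≤s l≤m) → cong (ν (n C l) *_) (sym (bernUpTo-stable (ℕ.≤⇒≤′ l≤m))) }))
         ([1+n]Cn≡1+n (suc m)) ⟩
  X + ν n * bernoulli (suc m)     ≡⟨ cong (λ z → X + ν n * z) (bernoulli-suc m) ⟩
  X + ν n * - (((+ 1) / n) * X)   ≡⟨ solve 3 (λ x a b → x ⊞ a ⊠ (⊟ (b ⊠ x)) := x ⊞ ⊟ ((b ⊠ a) ⊠ x)) refl X (ν n) ((+ 1) / n) ⟩
  X + - ((((+ 1) / n) * ν n) * X) ≡⟨ cong (λ z → X + - (z * X)) (1/-cancel n) ⟩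
  X + - (1ℚ * X)                  ≡⟨ solve 1 (λ x → x ⊞ ⊟ (con 1ℚ ⊠ x) := con 0ℚ) refl X ⟩
  0ℚ ∎
  where
  open ≡-Reasoning
  n = suc (suc m)
  X = sumTo (suc m) (λ l → ν (n C l) * bernUpTo m l)

-- This turns the binomial sum of the recurrence into a product of series.
ν-C : ∀ {n k} → k ℕ.≤ n → n !⁻¹ * ν (n C k) ≡ k !⁻¹ * (n ∸ k) !⁻¹
ν-C {n} {k} k≤n = begin
  n !⁻¹ * c             ≡⟨ solve 2 (λ x y → x ⊠ y := con 1ℚ ⊠ con 1ℚ ⊠ (x ⊠ y)) refl (n !⁻¹) c ⟩
  1ℚ * 1ℚ * (n !⁻¹ * c) ≡⟨ cong₂ (λ x y → x * y * (n !⁻¹ * c)) (!⁻¹-cancel k) (!⁻¹-cancel (n ∸ k)) ⟨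
  (a * ν (k !)) * (b * ν ((n ∸ k) !)) * (n !⁻¹ * c)
    ≡⟨ solve 6 (λ a a′ b b′ r c → (a ⊠ a′) ⊠ (b ⊠ b′) ⊠ (r ⊠ c) := (a ⊠ b) ⊠ (r ⊠ (c ⊠ (a′ ⊠ b′)))) refl
         a (ν (k !)) b (ν ((n ∸ k) !)) (n !⁻¹) c ⟩
  (a * b) * (n !⁻¹ * (c * (ν (k !) * ν ((n ∸ k) !)))) ≡⟨ cong (λ z → (a * b) * (n !⁻¹ * z)) factorials ⟩
  (a * b) * (n !⁻¹ * ν (n !))                         ≡⟨ cong ((a * b) *_) (!⁻¹-cancel n) ⟩
  (a * b) * 1ℚ                                        ≡⟨ ℚ.*-identityʳ (a * b) ⟩
  a * b ∎
  where
  open ≡-Reasoning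
  a = k !⁻¹
  b = (n ∸ k) !⁻¹
  c = ν (n C k)
  instance _ = k ℕ.!* (n ∸ k) !≢0
  factorials : c * (ν (k !) * ν ((n ∸ k) !)) ≡ ν (n !)
  factorials = trans (cong (c *_) (sym (ν-* (k !) ((n ∸ k) !))))
    (trans (sym (ν-* (n C k) (k ! ℕ.* (n ∸ k) !)))
    (cong ν (trans (cong (ℕ._* (k ! ℕ.* (n ∸ k) !)) (nCk≡n!/k![n-k]! k≤n)) (m/n*n≡m (k![n∸k]!∣n! k≤n)))))

β : ℕ → ℚ
β l = bernoulli l * l !⁻¹

-- The recurrence divided by `n !`, where `n = suc (suc m)`; the index exceeds the degree by one
-- because `u` has shifted factorials.
β∗u : ∀ m → (β ∗ u) (suc m) ≡ 0ℚ
β∗u m = begin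
  (β ∗ u) (suc m)                                   ≡⟨ ∗-sumTo (suc m) β u ⟨
  sumTo n (λ l → β l * u (suc m ∸ l))               ≡⟨ sumTo-cong-< n term ⟩
  sumTo n (λ l → n !⁻¹ * (ν (n C l) * bernoulli l)) ≡⟨ sumTo-*ˡ n _ (n !⁻¹) ⟨
  n !⁻¹ * sumTo n (λ l → ν (n C l) * bernoulli l)   ≡⟨ cong (n !⁻¹ *_) (bernoulli-recurrence m) ⟩
  n !⁻¹ * 0ℚ                                        ≡⟨ ℚ.*-zeroʳ (n !⁻¹) ⟩
  0ℚ ∎
  where
  open ≡-Reasoning
  n = suc (suc m)
  term : ∀ l → l ℕ.< n → β l * u (suc m ∸ l) ≡ n !⁻¹ * (ν (n C l) * bernoulli l)
  term l (s≤s l≤1+m) = begin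
    bernoulli l * l !⁻¹ * suc (suc m ∸ l) !⁻¹ ≡⟨ cong (λ k → bernoulli l * l !⁻¹ * k !⁻¹) (ℕ.+-∸-assoc 1 l≤1+m) ⟨
    bernoulli l * l !⁻¹ * (n ∸ l) !⁻¹         ≡⟨ ℚ.*-assoc (bernoulli l) (l !⁻¹) ((n ∸ l) !⁻¹) ⟩
    bernoulli l * (l !⁻¹ * (n ∸ l) !⁻¹)       ≡⟨ cong (bernoulli l *_) (ν-C (ℕ.m≤n⇒m≤1+n l≤1+m)) ⟨
    bernoulli l * (n !⁻¹ * ν (n C l))
      ≡⟨ solve 3 (λ b r c → b ⊠ (r ⊠ c) := r ⊠ (c ⊠ b)) refl (bernoulli l) (n !⁻¹) (ν (n C l)) ⟩
    n !⁻¹ * (ν (n C l) * bernoulli l) ∎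

-- Both sides are u′/u, as β u = 1 says (tail β + 1) u = u′.
dlog-sinc-bernoulli : ∀ j → dlog-sinc j + ½ * 1s j ≡ tail β j + 1s j
dlog-sinc-bernoulli = ∗-cancelʳ (λ j → dlog-sinc j + ½ * 1s j) (λ j → tail β j + 1s j) u refl (λ j → begin
  ((λ i → dlog-sinc i + ½ * 1s i) ∗ u) j ≡⟨ Row.∗-distribʳ u dlog-sinc (λ i → ½ * 1s i) j ⟩
  (dlog-sinc ∗ u) j + ((λ i → ½ * 1s i) ∗ u) j
    ≡⟨ cong (_+_ ((dlog-sinc ∗ u) j)) (trans (Row.∗-scaleˡ ½ 1s u j) (cong (½ *_) (Row.∗-identityˡ u j))) ⟩
  (dlog-sinc ∗ u) j + ½ * u j            ≡⟨ dlog-sinc∗u j ⟩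
  ν (suc j) * v j                        ≡⟨ ℚ.+-identityˡ (ν (suc j) * v j) ⟨
  0ℚ + ν (suc j) * v j                   ≡⟨ cong (_+ ν (suc j) * v j) (β∗u j) ⟨
  -- The coefficient of x^(j+1) in β u, with β 0 = 1 split off.
  1ℚ * v j + (tail β ∗ u) j + ν (suc j) * v j
    ≡⟨ solve 3 (λ v n t → con 1ℚ ⊠ v ⊞ t ⊞ n ⊠ v := t ⊞ (con 1ℚ ⊞ n) ⊠ v) refl (v j) (ν (suc j)) ((tail β ∗ u) j) ⟩
  (tail β ∗ u) j + (1ℚ + ν (suc j)) * v j ≡⟨ cong (λ z → (tail β ∗ u) j + z * v j) (ν-suc (suc j)) ⟨
  (tail β ∗ u) j + ν (suc (suc j)) * v j
    ≡⟨ cong (_+_ ((tail β ∗ u) j)) (trans (!⁻¹-suc (suc j)) (sym (Row.∗-identityˡ u j))) ⟩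
  (tail β ∗ u) j + (1s ∗ u) j             ≡⟨ Row.∗-distribʳ u (tail β) 1s j ⟨
  ((λ i → tail β i + 1s i) ∗ u) j ∎)
  where
  open ≡-Reasoning
  v = tail u

-- The constants ½ and 1 are felt in degree 0 only, where they leave `dlog-sinc 0 = β 1 + ½`; hence
-- the shift to `suc j`.
dlog-sinc-suc : ∀ j → dlog-sinc (suc j) ≡ β (suc (suc j))
dlog-sinc-suc j = trans (solve 1 (λ z → z := z ⊞ con ½ ⊠ con 0ℚ) refl (dlog-sinc (suc j)))
  (trans (dlog-sinc-bernoulli (suc j)) (ℚ.+-identityʳ (β (suc (suc j)))))

-- The coefficients of f_{k,j}

fCoeff-factor : ∀ k j n → fCoeff k j n ≡ ½ * (ν (j !) * (log1p (Gser k ⊖ oneS) n j - log1p (sincSer ⊖ oneS) n j))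
fCoeff-factor k j n = trans (cong (_* L) half) (ℚ.*-assoc ½ (ν (j !)) L)
  where
  L = log1p (Gser k ⊖ oneS) n j - log1p (sincSer ⊖ oneS) n j
  half : (+ (j !)) / 2 ≡ ½ * ν (j !)
  half = ν-cancelʳ 2 (trans (/-cancel (+ (j !)) 2) (solve 1 (λ x → x := con ½ ⊠ x ⊠ con (ν 2)) refl (ν (j !))))

-- The series G is 1 modulo q, so its logarithm contributes nothing. The logarithm of sinc
-- contributes -B_j/(2j), which the shift cancels.
shiftedCoeff-zero : ∀ k j → shiftedCoeff (suc (suc k)) (suc (suc j)) 0 ≡ 0ℚ
shiftedCoeff-zero k j = begin
  fCoeff k₂ j₂ 0 + bernoulli j₂ * inv2j j₂
    ≡⟨ cong₂ _+_ (trans (fCoeff-factor k₂ j₂ 0) (cong (λ x → ½ * (ν (j₂ !) * (x - L))) (log1p-row0 {Gser k₂ ⊖ oneS} (Gser-1-row0 k) j₂)))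
                 (cong (bernoulli j₂ *_) inv2j-half) ⟩
  ½ * (ν (j₂ !) * (0ℚ - L)) + bernoulli j₂ * (½ * w)
    ≡⟨ cong (λ x → ½ * (ν (j₂ !) * (0ℚ - x)) + bernoulli j₂ * (½ * w)) L-bernoulli ⟩
  ½ * (ν (j₂ !) * (0ℚ - w * (bernoulli j₂ * j₂ !⁻¹))) + bernoulli j₂ * (½ * w)
    ≡⟨ solve 4 (λ f w b r → con ½ ⊠ (f ⊠ (con 0ℚ ⊟′ w ⊠ (b ⊠ r))) ⊞ b ⊠ (con ½ ⊠ w) := con ½ ⊠ (w ⊠ b) ⊠ (con 1ℚ ⊟′ r ⊠ f)) refl
         (ν (j₂ !)) w (bernoulli j₂) (j₂ !⁻¹) ⟩
  ½ * (w * bernoulli j₂) * (1ℚ - j₂ !⁻¹ * ν (j₂ !)) ≡⟨ cong (λ x → ½ * (w * bernoulli j₂) * (1ℚ - x)) (!⁻¹-cancel j₂) ⟩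
  ½ * (w * bernoulli j₂) * (1ℚ - 1ℚ)                ≡⟨ ℚ.*-zeroʳ (½ * (w * bernoulli j₂)) ⟩
  0ℚ ∎
  where
  open ≡-Reasoning
  k₂ = suc (suc k)
  j₂ = suc (suc j)
  L = log1p (sincSer ⊖ oneS) 0 j₂
  w = (+ 1) / j₂
  inv2j-half : inv2j j₂ ≡ ½ * w
  inv2j-half = ν-cancelʳ (2 ℕ.* j₂) (trans (1/-cancel (2 ℕ.* j₂)) (sym (begin
    ½ * w * ν (2 ℕ.* j₂) ≡⟨ cong (½ * w *_) (ν-* 2 j₂) ⟩
    ½ * w * (ν 2 * ν j₂) ≡⟨ solve 2 (λ w n → con ½ ⊠ w ⊠ (con (ν 2) ⊠ n) := w ⊠ n) refl w (ν j₂) ⟩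
    w * ν j₂             ≡⟨ 1/-cancel j₂ ⟩
    1ℚ ∎)))
  L-bernoulli : L ≡ w * β j₂
  L-bernoulli = begin
    L              ≡⟨ ℚ.*-identityˡ L ⟨
    1ℚ * L         ≡⟨ cong (_* L) (1/-cancel j₂) ⟨
    w * ν j₂ * L   ≡⟨ ℚ.*-assoc w (ν j₂) L ⟩
    w * (ν j₂ * L) ≡⟨ cong (w *_) (trans (D-log1p sinc-1 0 (suc j)) (dlog-sinc-suc j)) ⟩
    w * β j₂ ∎

half-even : ∀ {q} → 2 ∣ℚ q → ∃ λ z → ½ * q ≡ ι z
half-even (divides z refl) = z , solve 1 (λ z → con ½ ⊠ (con (ν 2) ⊠ z) := z) refl (ι z)

-- The logarithm of sinc is free of q, and the evenness of log G absorbs the factor ½.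
shiftedCoeff-suc : ∀ k j n → ∃ λ z → shiftedCoeff k (suc j) (suc n) ≡ ι z
shiftedCoeff-suc k j n = proj₁ integer , (begin
  fCoeff k (suc j) (suc n)     ≡⟨ fCoeff-factor k (suc j) (suc n) ⟩
  ½ * (ν (suc j !) * (A - log1p sinc-1 (suc n) (suc j)))
    ≡⟨ cong (λ x → ½ * (ν (suc j !) * (A - x))) (log1p-QConst {sinc-1} sinc-1-qconst n (suc j)) ⟩
  ½ * (ν (suc j !) * (A - 0ℚ)) ≡⟨ cong (λ x → ½ * (ν (suc j !) * x)) (ℚ.+-identityʳ A) ⟩
  ½ * (ν (suc j !) * A)        ≡⟨ proj₂ integer ⟩
  ι (proj₁ integer) ∎)
  where
  open ≡-Reasoning
  A = log1p (Gser k ⊖ oneS) (suc n) (suc j)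
  integer : ∃ λ z → ½ * (ν (suc j !) * A) ≡ ι z
  integer = half-even (log1p-even (Even-⊖ (Even-Gser k) Even-oneS) (suc n) j)

theorem1p6 : (k j : ℕ) → 3 ≤ k → 2 ≤ j → (n : ℕ) →
    ∃ λ (z : ℤ) → shiftedCoeff k j n ≡ z / 1
theorem1p6 k             (suc j)       _        _        (suc n) = shiftedCoeff-suc k j n
-- The Bernoulli term cancels the constant coefficient exactly, so the integer is 0.
theorem1p6 (suc (suc k)) (suc (suc j)) _        _        zero    = + 0 , shiftedCoeff-zero k j
theorem1p6 (suc zero)    _             (s≤s ()) _        zero
theorem1p6 (suc (suc k)) (suc zero)    _        (s≤s ()) zero
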